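{- Let $q$ be a power of a prime $p$, let $\mathcal{T}$ be a multiset of points of $\mathrm{AG}(2,q)$ and let $\lambda$ be an integer with $0<\lambda\le (q-1)/2$. Let $\mathcal{E}_\lambda$ be a set of $(q-\lambda)$-uniform directions w.r.t. $\mathcal{T}$, of size at most $q$, and assume that there is at least one sharply $(q-\lambda)$-uniform direction in $\mathcal{E}_\lambda$. Then the renitent lines with slope in $\mathcal{E}_\lambda$ are contained in an algebraic envelope of class $\lambda^2$ with the following properties: (1) if a direction $(u)$ of $\mathcal{E}_\lambda$ is $(q-\lambda_u)$-uniform for some $0\le\lambda_u<\lambda$, then the line pencil centered at $(u)$ is fully contained with multiplicity $(\lambda-\lambda_u)$ in the envelope; (2) pencils centered at sharply $(q-\lambda)$-uniform directions are not contained in the envelope.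
   Context: $\mathrm{AG}(2,q)$ is the desarguesian affine plane over $\mathbb{F}_q$, embedded in $\mathrm{PG}(2,q)$ as the set of points $(a:b:1)$; the line at infinity is $\ell_\infty=[0:0:1]$. Here $[u:v:w]$ denotes the line $\{(x:y:z): ux+vy+wz=0\}$. The points of $\ell_\infty$ are called directions: $(d)=(1:d:0)$ for $d\in\mathbb{F}_q$ and $(\infty)=(0:1:0)$. The affine lines with slope (direction) $d$ are the $q$ affine lines through $(d)$. Multisets are finite, and intersection sizes with $\mathcal{T}$ are counted with multiplicity. For an integer $\mu$, a direction $(d)$ is $(q-\mu)$-uniform w.r.t. $\mathcal{T}$ if at least $q-\mu$ affine lines with slope $d$ meet $\mathcal{T}$ in the same number of points modulo $p$; this number (modulo $p$) is the typical intersection number at $(d)$ (it is unique when $\mu\le (q-1)/2$). The other affine lines with slope $d$ (those whose intersection size with $\mathcal{T}$ is not congruent to the typical intersection number modulo $p$) are called renitent. A direction $(d)$ is sharply $(q-\mu)$-uniform if exactly $q-\mu$ affine lines with slope $d$ meet $\mathcal{T}$ in the typical intersection number of points modulo $p$. An algebraic envelope of class $n$ is a curve of degree $n$ in the dual plane, i.e. it is given by a nonzero homogeneous polynomial $g\in\mathbb{F}_q[U,V,W]$ of degree $n$; a line $[u:v:w]$ is contained in it if $g(u,v,w)=0$. The pencil centered at a point $P=(x:y:z)$ is the set of lines through $P$, which is the line $xU+yV+zW=0$ of the dual plane. The pencil is contained in the envelope if $xU+yV+zW$ divides $g$, and it is (fully) contained with multiplicity $k$ if $(xU+yV+zW)^k$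 divides $g$. -}

module Defs where

open import Algebra.Bundles using (CommutativeRing; RawSemiring; Semiring)
open import Algebra.Structures using (IsCommutativeRing)
import Algebra.Definitions.RawMagma as RawMagmaDefs
import Algebra.Definitions.RawSemiring as RawSemiringDefs
open import Data.Fin using (Fin)
import Data.Fin.Properties as Fin
open import Data.List using (List; []; _∷_; _++_; map; foldr; filter; length; allFin; cartesianProductWith)
open import Data.Nat as ℕ using (ℕ; _≤_; ∣_-_∣)
open import Data.Nat.Divisibility as ℕ∣ using (_∣?_)
import Data.Nat.Properties as ℕ
open import Data.Product using (_×_; _,_; proj₁; proj₂; ∃-syntax)
open import Data.Vec using (Vec; []; _∷_; zipWith; replicate; sum)
import Data.Vec as Vec
import Data.Vec.Properties as Vec
open import Function.Bundles using (_↔_; Inverse)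
open import Function.Properties.Inverse using (↔-sym; ↔⇒↣)
open import Level using (0ℓ)
open import Relation.Binary.Definitions using (DecidableEquality)
open import Relation.Binary.PropositionalEquality using (_≡_; _≢_)
open import Relation.Nullary using (¬_; Dec)

-- The Heyting fields of the library carry an apartness relation. A finite
-- field has decidable equality, so here equality is _≡_ and "apart from zero"
-- is _≢ 0#.
record FiniteField (q : ℕ) : Set₁ where
  infix  8 -_
  infixl 7 _*_
  infixl 6 _+_
  field
    Carrier           : Set
    _+_ _*_           : Carrier → Carrier → Carrier
    -_                : Carrier → Carrier
    0# 1#             : Carrier
    isCommutativeRing : IsCommutativeRing _≡_ _+_ _*_ -_ 0# 1#
    1≢0               : 1# ≢ 0#
    invertible        : ∀ x → x ≢ 0# → ∃[ y ] x * y ≡ 1#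
    enumeration       : Fin q ↔ Carrier

  commutativeRing : CommutativeRing 0ℓ 0ℓ
  commutativeRing = record { isCommutativeRing = isCommutativeRing }

  open RawSemiringDefs (Semiring.rawSemiring (CommutativeRing.semiring commutativeRing)) public
    using (_^_)

  infix 4 _≟_
  _≟_ : DecidableEquality Carrier
  _≟_ = Fin.inj⇒≟ (↔⇒↣ (↔-sym enumeration))

  elements : List Carrier
  elements = map (Inverse.to enumeration) (allFin q)

-- A polynomial in three variables over F is a finite formal sum of terms
-- c · U^i V^j W^k, stored as (c , i ∷ j ∷ k ∷ []). Exponents may repeat and
-- coefficients may vanish, so polynomials are compared by _≈ₚ_, not by _≡_.
module Polynomial {q : ℕ} (F : FiniteField q) where
  open FiniteField F

  Exponent : Set
  Exponent = Vec ℕ 3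

  _≟ᵉ_ : DecidableEquality Exponent
  _≟ᵉ_ = Vec.≡-dec ℕ._≟_

  Poly : Set
  Poly = List (Carrier × Exponent)

  coeff : Poly → Exponent → Carrier
  coeff f e = foldr _+_ 0# (map proj₁ (filter (λ t → proj₂ t ≟ᵉ e) f))

  infix 4 _≈ₚ_
  _≈ₚ_ : Poly → Poly → Set
  f ≈ₚ g = ∀ e → coeff f e ≡ coeff g e

  _+ₚ_ _*ₚ_ : Poly → Poly → Poly
  f +ₚ g = f ++ g
  f *ₚ g = cartesianProductWith
             (λ (c , d) (c′ , d′) → (c * c′) , zipWith ℕ._+_ d d′) f g

  0ₚ 1ₚ : Poly
  0ₚ = []
  1ₚ = (1# , replicate 3 0) ∷ []

  rawSemiring : RawSemiring 0ℓ 0ℓ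
  rawSemiring = record
    { Carrier = Poly ; _≈_ = _≈ₚ_ ; _+_ = _+ₚ_ ; _*_ = _*ₚ_ ; 0# = 0ₚ ; 1# = 1ₚ }

  open RawSemiringDefs rawSemiring public
    using () renaming (_^_ to _^ₚ_)
  open RawMagmaDefs (RawSemiring.*-rawMagma rawSemiring) public
    using () renaming (_∣_ to _∣ₚ_)

  evalMonomial : Exponent → Vec Carrier 3 → Carrier
  evalMonomial e x = Vec.foldr′ _*_ 1# (zipWith _^_ x e)

  eval : Poly → Vec Carrier 3 → Carrier
  eval f x = foldr _+_ 0# (map (λ (c , e) → c * evalMonomial e x) f)

  Homogeneous : ℕ → Poly → Set
  Homogeneous n f = ∀ e → coeff f e ≢ 0# → sum e ≡ n

-- Points and lines of PG(2,q) are given by homogeneous coordinates.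
module Plane {q : ℕ} (F : FiniteField q) where
  open FiniteField F
  open Polynomial F

  Coordinates : Set
  Coordinates = Vec Carrier 3

  dot : Coordinates → Coordinates → Carrier
  dot (u ∷ v ∷ w ∷ []) (x ∷ y ∷ z ∷ []) = u * x + v * y + w * z

  AffinePoint : Set
  AffinePoint = Carrier × Carrier

  embed : AffinePoint → Coordinates
  embed (a , b) = a ∷ b ∷ 1# ∷ []

  data Direction : Set where
    slope : Carrier → Direction
    ∞     : Direction

  point : Direction → Coordinates
  point (slope d) = 1# ∷ d ∷ 0# ∷ []
  point ∞         = 0# ∷ 1# ∷ 0# ∷ []

  -- As b ranges over F, each of the q affine lines through the direction
  -- occurs exactly once: y = d x + b for slope d, and x = b for ∞.
  line : Direction → Carrier → Coordinates
  line (slope d) b = d ∷ - 1# ∷ b ∷ []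
  line ∞         b = - 1# ∷ 0# ∷ b ∷ []

  -- The linear form x U + y V + z W, i.e. the pencil centred at (x : y : z).
  pencil : Coordinates → Poly
  pencil (x ∷ y ∷ z ∷ []) =
    (x , 1 ∷ 0 ∷ 0 ∷ []) ∷ (y , 0 ∷ 1 ∷ 0 ∷ []) ∷ (z , 0 ∷ 0 ∷ 1 ∷ []) ∷ []

  record Envelope (n : ℕ) : Set where
    field
      form        : Poly
      homogeneous : Homogeneous n form
      nonzero     : ¬ (form ≈ₚ 0ₚ)

  open Envelope

  ContainsLine : ∀ {n} → Envelope n → Coordinates → Set
  ContainsLine 𝓖 l = eval (form 𝓖) l ≡ 0#

  ContainsPencil : ∀ {n} → Envelope n → Direction → Set
  ContainsPencil 𝓖 D = pencil (point D) ∣ₚ form 𝓖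

  ContainsPencilWithMultiplicity : ∀ {n} → Envelope n → Direction → ℕ → Set
  ContainsPencilWithMultiplicity 𝓖 D k = (pencil (point D) ^ₚ k) ∣ₚ form 𝓖

  -- A finite multiset is a list: everything below is invariant under
  -- permutations of it.
  Multiset : Set
  Multiset = List AffinePoint

  intersectionSize : Multiset → Coordinates → ℕ
  intersectionSize 𝓣 l = length (filter (λ P → dot l (embed P) ≟ 0#) 𝓣)

  module Uniformity (p : ℕ) (𝓣 : Multiset) where

    infix 4 _≡ₘ_ _≡ₘ?_
    _≡ₘ_ : ℕ → ℕ → Set
    m ≡ₘ n = p ℕ∣.∣ ∣ m - n ∣

    _≡ₘ?_ : ∀ m n → Dec (m ≡ₘ n)
    m ≡ₘ? n = p ∣? ∣ m - n ∣

    linesMeetingIn : Direction → ℕ → ℕ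
    linesMeetingIn D t =
      length (filter (λ b → intersectionSize 𝓣 (line D b) ≡ₘ? t) elements)

    -- In what follows k stands for q - μ. The residue class of t is
    -- determined by Typical k D t as soon as 2k > q.
    Typical : ℕ → Direction → ℕ → Set
    Typical k D t = k ≤ linesMeetingIn D t

    Uniform : ℕ → Direction → Set
    Uniform k D = ∃[ t ] Typical k D t

    SharplyUniform : ℕ → Direction → Set
    SharplyUniform k D = ∃[ t ] Typical k D t × linesMeetingIn D t ≡ k

    Renitent : ℕ → Direction → Carrier → Set
    Renitent k D b =
      ∃[ t ] Typical k D t × ¬ (intersectionSize 𝓣 (line D b) ≡ₘ t)

{-# OPTIONS --safe #-}
-- A point P = (a , b) lies on the line [u : v : w] (with v = - 1 or u = - 1,
-- v = 0) if and only if w = z_P, where z_P = - (a u + b v). Put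
-- r_j = ∑_P z_Pʲ (W - z_P), a form of degree j + 1. The envelope is the
-- determinant of the Hankel matrix (r_{i+j}), 0 ≤ i, j < λ, of degree λ².
--
-- Specialise to the lines through a direction D with typical intersection
-- number t. As ∑ cʲ = 0 over the field for j ≤ q - 2, only the atypical lines
-- contribute to the power sums ∑ z_Pʲ, so r_j becomes a sum of exponentials
-- α_c cʲ over the atypical intercepts c, with α_c a nonzero multiple of W - c.
-- The Hankel determinant of such a sum vanishes when fewer than λ terms are
-- nonzero, in particular when W is itself one of the at most λ intercepts c, and
-- it is the product of all α_c and of a squared Vandermonde determinant when
-- there are exactly λ terms.
-- Modulo the pencil of D the same formula holds up to powers of a linear form,
-- and if there are m atypical lines then row operations make λ - m rows
-- divisible by the pencil.
module Submission where

open import Defs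
open import Algebra.Bundles using (CommutativeRing)
open import Algebra.Definitions.RawMagma using (_,_)
import Algebra.Morphism.Construct.Identity as Identity
open import Algebra.Morphism.Structures using (module RingMorphisms)
import Algebra.Solver.Ring as RingSolver
open import Algebra.Solver.Ring.AlmostCommutativeRing
  using (fromCommutativeRing; _-Raw-AlmostCommutative⟶_)
open import Data.Integer as ℤ using (ℤ; -[1+_]; _⊖_; _◃_)
import Data.Integer.Properties as ℤ
open import Data.List
  using (List; []; _∷_; map; foldr; length; filter; allFin; replicate; upTo; applyUpTo)
open import Data.List.Membership.Propositional using (_∈_; lose)
open import Data.List.Membership.Propositional.Properties
  using (∈-map⁺; ∈-allFin; ∈-filter⁺; ∈-filter⁻)
open import Data.List.Properties
  using (++-assoc; ++-identityʳ; length-map; length-tabulate; length-replicate;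
         length-upTo; map-∘; map-id; map-upTo; filter-notAll)
open import Data.List.Relation.Unary.All as All using (All; []; _∷_)
import Data.List.Relation.Unary.All.Properties as All
open import Data.List.Relation.Unary.AllPairs as AllPairs using (AllPairs; []; _∷_)
open import Data.List.Relation.Unary.Any as Any using (here; there)
open import Data.List.Relation.Unary.Unique.Propositional using (Unique)
open import Data.List.Relation.Unary.Unique.Propositional.Properties
  using (map⁺; allFin⁺; filter⁺)
open import Data.Maybe using (Maybe; just; nothing)
open import Data.Nat as ℕ using (ℕ; zero; suc; _∸_; ∣_-_∣; s≤s; z≤n; NonZero)
open import Data.Nat.Coprimality using (prime⇒coprime; coprime-Bézout)
open import Data.Nat.Divisibility using (divides; m%n≡0⇒n∣m) renaming (_∣_ to _∣ℕ_)
open import Data.Nat.DivMod using (_%_; _/_; m≡m%n+[m/n]*n; m%n<n)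
open import Data.Nat.GCD using (module Bézout)
open import Data.Nat.ListAction using (sum)
open import Data.Nat.Primality using (Prime; prime⇒nonZero)
import Data.Nat.Properties as ℕ
import Data.Nat.Solver as ℕ
open import Data.Product using (_×_; _,_; proj₁; proj₂; ∃-syntax; Σ-syntax)
open import Data.Sign as Sign using (Sign)
open import Data.Sum using (_⊎_; inj₁; inj₂)
open import Data.Vec as Vec using ([]; _∷_)
import Data.Vec.Properties as Vec
open import Function using (_∘_; id)
open import Function.Bundles using (Injection; Inverse)
open import Function.Properties.Inverse using (↔⇒↣)
open import Level using (0ℓ; _⊔_)
open import Relation.Binary.PropositionalEquality as ≡ using (_≡_; _≢_)
open import Relation.Nullary using (Dec; yes; no; ¬_; ¬?; contradiction)
open import Relation.Nullary.Decidable using (_×-dec_; decidable-stable)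

-- The bound on λ is what the Hankel matrix asks for: its last entry r_{2λ-2} involves the power
-- sums of exponents 2λ - 2 and 2λ - 1, while ∑ cʲ = 0 reaches up to q - 2. The obstacle is that the
-- reduction to atypical lines is an identity only on the lines through one direction. In three
-- variables it is a congruence, since a U + b V is a scalar multiple of a linear form independent
-- of (a , b) only modulo the pencil. Congruences are therefore carried as divisibilities d ∣ x - y,
-- and one induction over the exponentials serves two ends. With d the pencil form it gives property
-- (1); with d = 0 in the field, where divisibility is equality, it gives the vanishing at renitent
-- lines. Nonvanishing is tested by a value in the field, at a typical line through a sharply
-- uniform direction. There W - c is nonzero for every atypical c, so all λ exponentials survive,
-- while the pencil form is zero. This value makes the envelope a nonzero form and yields property
-- (2).

-- A solver with integer coefficients, so that cancellations are recognised in
-- rings without decidable equality.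
module IntegerSolver {a b} (A : CommutativeRing a b) where
  open CommutativeRing A
  open import Algebra.Properties.Ring ring
    using (-‿involutive; -0#≈0#; -‿distribˡ-*; -‿distribʳ-*; -‿+-comm)
  open import Algebra.Properties.Semiring.Mult.TCOptimised semiring using (1+×; ×-homo-+; ×1-homo-*)
    renaming (_×_ to _·_)
  open import Data.Integer using (+_)
  open import Relation.Binary.Reasoning.Setoid setoid

  private
    ⟦_⟧ℤ : ℤ → Carrier
    ⟦ + n ⟧ℤ      = n · 1#
    ⟦ -[1+ n ] ⟧ℤ = - (suc n · 1#)

    ⊖-homo : ∀ m n → ⟦ m ⊖ n ⟧ℤ ≈ m · 1# - n · 1#
    ⊖-homo m zero = sym (trans (+-congˡ -0#≈0#) (+-identityʳ _))
    ⊖-homo zero (suc n) = sym (+-identityˡ _)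
    ⊖-homo (suc m) (suc n) = begin
      ⟦ suc m ⊖ suc n ⟧ℤ                           ≡⟨ ≡.cong ⟦_⟧ℤ (ℤ.[1+m]⊖[1+n]≡m⊖n m n) ⟩
      ⟦ m ⊖ n ⟧ℤ                                   ≈⟨ ⊖-homo m n ⟩
      m · 1# - n · 1#                             ≈⟨ +-congʳ (+-identityˡ _) ⟨
      0# + m · 1# - n · 1#                        ≈⟨ +-congʳ (+-congʳ (-‿inverseʳ 1#)) ⟨
      1# - 1# + m · 1# - n · 1#                   ≈⟨ +-congʳ (+-assoc _ _ _) ⟩
      1# + (- 1# + m · 1#) - n · 1#               ≈⟨ +-congʳ (+-congˡ (+-comm _ _)) ⟩
      1# + (m · 1# - 1#) - n · 1#                 ≈⟨ +-congʳ (+-assoc _ _ _) ⟨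
      1# + m · 1# - 1# - n · 1#                   ≈⟨ +-assoc _ _ _ ⟩
      1# + m · 1# + (- 1# - n · 1#)               ≈⟨ +-congˡ (-‿+-comm _ _) ⟩
      1# + m · 1# - (1# + n · 1#)                 ≈⟨ +-cong (1+× m 1#) (-‿cong (1+× n 1#)) ⟨
      suc m · 1# - suc n · 1#                     ∎

    ◃-homo₊ : ∀ n → ⟦ Sign.+ ◃ n ⟧ℤ ≈ n · 1#
    ◃-homo₊ zero    = refl
    ◃-homo₊ (suc n) = refl

    ◃-homo₋ : ∀ n → ⟦ Sign.- ◃ n ⟧ℤ ≈ - (n · 1#)
    ◃-homo₋ zero    = sym -0#≈0#
    ◃-homo₋ (suc n) = refl

    +-homo : ∀ i j → ⟦ i ℤ.+ j ⟧ℤ ≈ ⟦ i ⟧ℤ + ⟦ j ⟧ℤ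
    +-homo (+ m) (+ n) = ×-homo-+ 1# m n
    +-homo (+ m) -[1+ n ] = ⊖-homo m (suc n)
    +-homo -[1+ m ] (+ n) = trans (⊖-homo n (suc m)) (+-comm _ _)
    +-homo -[1+ m ] -[1+ n ] = begin
      - (suc (suc (m ℕ.+ n)) · 1#)        ≡⟨ ≡.cong (λ k → - (suc k · 1#)) (ℕ.+-suc m n) ⟨
      - ((suc m ℕ.+ suc n) · 1#)          ≈⟨ -‿cong (×-homo-+ 1# (suc m) (suc n)) ⟩
      - (suc m · 1# + suc n · 1#)         ≈⟨ -‿+-comm _ _ ⟨
      - (suc m · 1#) - suc n · 1#         ∎

    *-homo : ∀ i j → ⟦ i ℤ.* j ⟧ℤ ≈ ⟦ i ⟧ℤ * ⟦ j ⟧ℤ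
    *-homo (+ m) (+ n) = trans (◃-homo₊ (m ℕ.* n)) (×1-homo-* m n)
    *-homo (+ m) -[1+ n ] =
      trans (◃-homo₋ (m ℕ.* suc n)) (trans (-‿cong (×1-homo-* m (suc n))) (-‿distribʳ-* _ _))
    *-homo -[1+ m ] (+ n) =
      trans (◃-homo₋ (suc m ℕ.* n)) (trans (-‿cong (×1-homo-* (suc m) n)) (-‿distribˡ-* _ _))
    *-homo -[1+ m ] -[1+ n ] = begin
      ⟦ Sign.+ ◃ suc m ℕ.* suc n ⟧ℤ        ≈⟨ ◃-homo₊ (suc m ℕ.* suc n) ⟩
      (suc m ℕ.* suc n) · 1#              ≈⟨ ×1-homo-* (suc m) (suc n) ⟩
      suc m · 1# * suc n · 1#             ≈⟨ -‿involutive _ ⟨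
      - - (suc m · 1# * suc n · 1#)       ≈⟨ -‿cong (-‿distribʳ-* _ _) ⟩
      - (suc m · 1# * - (suc n · 1#))     ≈⟨ -‿distribˡ-* _ _ ⟩
      - (suc m · 1#) * - (suc n · 1#)     ∎

    -‿homo : ∀ i → ⟦ ℤ.- i ⟧ℤ ≈ - ⟦ i ⟧ℤ
    -‿homo (+ zero)  = sym -0#≈0#
    -‿homo (+ suc n) = refl
    -‿homo -[1+ n ]  = sym (-‿involutive _)

    morphism : ℤ.+-*-rawRing -Raw-AlmostCommutative⟶ fromCommutativeRing A
    morphism = record
      { ⟦_⟧ = ⟦_⟧ℤ ; +-homo = +-homo ; *-homo = *-homo ; -‿homo = -‿homo
      ; 0-homo = refl ; 1-homo = refl }

    coefficientEquality : ∀ i j → Maybe (⟦ i ⟧ℤ ≈ ⟦ j ⟧ℤ)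
    coefficientEquality i j with i ℤ.≟ j
    ... | yes i≡j = just (reflexive (≡.cong ⟦_⟧ℤ i≡j))
    ... | no _    = nothing

  private
    module Solver = RingSolver ℤ.+-*-rawRing (fromCommutativeRing A) morphism coefficientEquality
  open Solver public using (solve; _:=_; _:+_; _:*_; _:-_; :-_)

  :0 :1 : ∀ {n} → Solver.Polynomial n
  :0 = Solver.con (+ 0)
  :1 = Solver.con (+ 1)

-- Determinants as iterated contractions.

-- The determinant of the matrix with rows r₁, …, rₙ (sequences) in a list of
-- columns is contract r₁ (… (contract rₙ unit)) at that list, by expansion along
-- the first row. Contractions anticommute and square to zero, like the
-- antiderivations of an exterior algebra, which is all that row operations need.
module Contraction {a b} (A : CommutativeRing a b) where
  open CommutativeRing A
  open IntegerSolver A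
  open import Algebra.Properties.Ring ring using (-1*x≈-x; -‿distribˡ-*)
  open import Algebra.Properties.Semiring.Exp semiring using (_^_)
  open import Algebra.Properties.CommutativeSemigroup.Divisibility *-commutativeSemigroup
    using (_∣_; ∣-respʳ-≈; ∣-respˡ-≈; ∙-cong-∣; x∣ʳy⇒x∣ʳzy)
  open import Algebra.Properties.Semiring.Divisibility semiring using (1∣_; _∣0)
  open import Relation.Binary.Reasoning.Setoid setoid

  Row Form : Set a
  Row  = ℕ → Carrier
  Form = List ℕ → Carrier

  -- A column is either taken by `r` or kept in front for `G`; the minus sign in the second case
  -- accumulates to the alternating signs of the expansion.
  contract : Row → Form → Form
  contract r G []       = 0#
  contract r G (c ∷ cs) = r c * G cs - contract r (λ ds → G (c ∷ ds)) cs

  -- The determinant of the empty matrix. Its value 0 on leftover columns makes the determinant of a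
  -- matrix with too many columns zero.
  unit : Form
  unit []      = 1#
  unit (_ ∷ _) = 0#

  wedge : List Row → Form → Form
  wedge rs G = foldr contract G rs

  shift : Row → Row
  shift r j = r (suc j)

  -- Each row of a Hankel matrix is the shift of the row above, so the first row determines all `n`
  -- of them; `G` stands for the rows that follow.
  hankel : Row → ℕ → Form → Form
  hankel r zero    G = G
  hankel r (suc n) G = contract r (hankel (shift r) n G)

  ∣-sub : ∀ {d x y} → d ∣ x → d ∣ y → d ∣ x - y
  ∣-sub {d} (p , pd≈x) (q , qd≈y) =
    p - q , trans (solve 3 (λ p q d → (p :- q) :* d := p :* d :- q :* d) refl p q d)
                  (+-cong pd≈x (-‿cong qd≈y))

  -- The predicate `P` restricts the columns, because the divisibilities fed in later hold only for
  -- entries of bounded index.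
  contract-∣ : ∀ {P : ℕ → Set} {d e r G} → (∀ {c} → P c → d ∣ r c) →
    (∀ {cs} → All P cs → e ∣ G cs) → ∀ {cs} → All P cs → d * e ∣ contract r G cs
  contract-∣ d∣r e∣G []         = _ ∣0
  contract-∣ d∣r e∣G (pc ∷ pcs) =
    ∣-sub (∙-cong-∣ (d∣r pc) (e∣G pcs)) (contract-∣ d∣r (λ p → e∣G (pc ∷ p)) pcs)

  contract-cong-on : ∀ {P : ℕ → Set} {r s G H} → (∀ {c} → P c → r c ≈ s c) →
    (∀ {cs} → All P cs → G cs ≈ H cs) → ∀ {cs} → All P cs → contract r G cs ≈ contract s H cs
  contract-cong-on r≈s G≈H []         = refl
  contract-cong-on r≈s G≈H (pc ∷ pcs) =
    +-cong (*-cong (r≈s pc) (G≈H pcs))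
           (-‿cong (contract-cong-on r≈s (λ p → G≈H (pc ∷ p)) pcs))

  contract-cong : ∀ {r s G H} → (∀ c → r c ≈ s c) → (∀ cs → G cs ≈ H cs) →
    ∀ cs → contract r G cs ≈ contract s H cs
  contract-cong r≈s G≈H []       = refl
  contract-cong r≈s G≈H (c ∷ cs) =
    +-cong (*-cong (r≈s c) (G≈H cs)) (-‿cong (contract-cong r≈s (λ ds → G≈H (c ∷ ds)) cs))

  0≈x*0+y*0 : ∀ x y → 0# ≈ x * 0# + y * 0#
  0≈x*0+y*0 x y = sym (trans (+-cong (zeroʳ x) (zeroʳ y)) (+-identityʳ 0#))

  contract-linear : ∀ {G H K} r x y → (∀ cs → G cs ≈ x * H cs + y * K cs) →
    ∀ cs → contract r G cs ≈ x * contract r H cs + y * contract r K cs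
  contract-linear {G} {H} {K} r x y G≈ []       = 0≈x*0+y*0 x y
  contract-linear {G} {H} {K} r x y G≈ (c ∷ cs) = begin
    r c * G cs - contract r (G ∘ (c ∷_)) cs
      ≈⟨ +-cong (*-congˡ (G≈ cs)) (-‿cong (contract-linear r x y (λ ds → G≈ (c ∷ ds)) cs)) ⟩
    r c * (x * H cs + y * K cs) - (x * contract r (H ∘ (c ∷_)) cs + y * contract r (K ∘ (c ∷_)) cs)
      ≈⟨ solve 7 (λ h k x y r H K → r :* (x :* H :+ y :* K) :- (x :* h :+ y :* k) :=
                                    x :* (r :* H :- h) :+ y :* (r :* K :- k))
           refl (contract r (H ∘ (c ∷_)) cs) (contract r (K ∘ (c ∷_)) cs) x y (r c) (H cs) (K cs) ⟩
    x * (r c * H cs - contract r (H ∘ (c ∷_)) cs) + y * (r c * K cs - contract r (K ∘ (c ∷_)) cs) ∎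

  contract-row-linear : ∀ {r s t} x y G → (∀ j → r j ≈ x * s j + y * t j) →
    ∀ cs → contract r G cs ≈ x * contract s G cs + y * contract t G cs
  contract-row-linear {r} {s} {t} x y G r≈ []       = 0≈x*0+y*0 x y
  contract-row-linear {r} {s} {t} x y G r≈ (c ∷ cs) = begin
    r c * G cs - contract r (G ∘ (c ∷_)) cs
      ≈⟨ +-cong (*-congʳ (r≈ c)) (-‿cong (contract-row-linear x y (G ∘ (c ∷_)) r≈ cs)) ⟩
    (x * s c + y * t c) * G cs - (x * contract s (G ∘ (c ∷_)) cs + y * contract t (G ∘ (c ∷_)) cs)
      ≈⟨ solve 7 (λ h k x y s t G → (x :* s :+ y :* t) :* G :- (x :* h :+ y :* k) :=
                                    x :* (s :* G :- h) :+ y :* (t :* G :- k))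
           refl (contract s (G ∘ (c ∷_)) cs) (contract t (G ∘ (c ∷_)) cs) x y (s c) (t c) (G cs) ⟩
    x * (s c * G cs - contract s (G ∘ (c ∷_)) cs) + y * (t c * G cs - contract t (G ∘ (c ∷_)) cs) ∎

  -- A vanishing form satisfies G = 0 G + 0 G, so this is an instance of linearity.
  contract-zero : ∀ {G} r → (∀ cs → G cs ≈ 0#) → ∀ cs → contract r G cs ≈ 0#
  contract-zero {G} r G≈0 cs = begin
    contract r G cs                                 ≈⟨ contract-linear r 0# 0# 0≈ cs ⟩
    0# * contract r G cs + 0# * contract r G cs     ≈⟨ +-cong (zeroˡ _) (zeroˡ _) ⟩
    0# + 0#                                         ≈⟨ +-identityʳ 0# ⟩
    0#                                              ∎
    where
    0≈ : ∀ ds → G ds ≈ 0# * G ds + 0# * G ds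
    0≈ ds = trans (G≈0 ds) (sym (trans (+-cong (zeroˡ _) (zeroˡ _)) (+-identityʳ 0#)))

  -- The first column is taken by `r`, by `s`, or by neither. The first two cases have opposite
  -- signs, which is the source of both rules below.
  contract-contract-∷ : ∀ r s G c cs → contract r (contract s G) (c ∷ cs) ≈
    r c * contract s G cs - s c * contract r G cs + contract r (contract s (G ∘ (c ∷_))) cs
  contract-contract-∷ r s G c cs = begin
    r c * contract s G cs - contract r (λ ds → s c * G ds - contract s (G ∘ (c ∷_)) ds) cs
      ≈⟨ +-congˡ (-‿cong (contract-linear r (s c) (- 1#) (λ ds → +-congˡ (sym (-1*x≈-x _))) cs)) ⟩
    r c * contract s G cs - (s c * contract r G cs + - 1# * contract r (contract s (G ∘ (c ∷_))) cs)
      ≈⟨ +-congˡ (-‿cong (+-congˡ (-1*x≈-x _))) ⟩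
    r c * contract s G cs - (s c * contract r G cs - contract r (contract s (G ∘ (c ∷_))) cs)
      ≈⟨ solve 3 (λ x y z → x :- (y :- z) := x :- y :+ z) refl _ _ _ ⟩
    r c * contract s G cs - s c * contract r G cs + contract r (contract s (G ∘ (c ∷_))) cs ∎

  -- Proved directly: anticommutativity would only give that twice the value is zero, which says
  -- nothing in characteristic 2.
  contract-square : ∀ r G cs → contract r (contract r G) cs ≈ 0#
  contract-square r G []       = refl
  contract-square r G (c ∷ cs) = begin
    contract r (contract r G) (c ∷ cs)
      ≈⟨ contract-contract-∷ r r G c cs ⟩
    r c * contract r G cs - r c * contract r G cs + contract r (contract r (G ∘ (c ∷_))) cs
      ≈⟨ +-cong (-‿inverseʳ _) (contract-square r (G ∘ (c ∷_)) cs) ⟩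
    0# + 0#
      ≈⟨ +-identityʳ 0# ⟩
    0# ∎

  contract-anticomm : ∀ r s G cs → contract r (contract s G) cs ≈ - 1# * contract s (contract r G) cs
  contract-anticomm r s G []       = sym (zeroʳ _)
  contract-anticomm r s G (c ∷ cs) = begin
    contract r (contract s G) (c ∷ cs)
      ≈⟨ contract-contract-∷ r s G c cs ⟩
    r c * contract s G cs - s c * contract r G cs + contract r (contract s (G ∘ (c ∷_))) cs
      ≈⟨ +-congˡ (trans (contract-anticomm r s (G ∘ (c ∷_)) cs) (-1*x≈-x _)) ⟩
    r c * contract s G cs - s c * contract r G cs - contract s (contract r (G ∘ (c ∷_))) cs
      ≈⟨ solve 3 (λ x y z → x :- y :- z := :- (y :- x :+ z)) refl _ _ _ ⟩
    - (s c * contract r G cs - r c * contract s G cs + contract s (contract r (G ∘ (c ∷_))) cs)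
      ≈⟨ -‿cong (contract-contract-∷ s r G c cs) ⟨
    - contract s (contract r G) (c ∷ cs)
      ≈⟨ -1*x≈-x _ ⟨
    - 1# * contract s (contract r G) (c ∷ cs) ∎

  contract-row-op : ∀ {r s t} x G → (∀ j → t j ≈ s j + x * r j) →
    ∀ cs → contract r (contract t G) cs ≈ contract r (contract s G) cs
  contract-row-op {r} {s} {t} x G t≈ cs = begin
    contract r (contract t G) cs
      ≈⟨ contract-linear r 1# x
           (contract-row-linear 1# x G (λ j → trans (t≈ j) (+-congʳ (sym (*-identityˡ _))))) cs ⟩
    1# * contract r (contract s G) cs + x * contract r (contract r G) cs
      ≈⟨ +-cong (*-identityˡ _) (trans (*-congˡ (contract-square r G cs)) (zeroʳ x)) ⟩
    contract r (contract s G) cs + 0#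
      ≈⟨ +-identityʳ _ ⟩
    contract r (contract s G) cs ∎

  -- Subtracting `x` times each row from the row below it preserves the Hankel shape below the first
  -- row. With `x` a node of an exponential sum, this removes that node from all later rows.
  hankel-step : ∀ r x n G cs → contract r (hankel (λ j → r (suc j) - x * r j) n G) cs ≈
    contract r (hankel (shift r) n G) cs
  hankel-step r x zero    G cs = refl
  hankel-step r x (suc n) G cs = begin
    contract r (contract (λ j → r (suc j) - x * r j) (hankel (λ j → r (2 ℕ.+ j) - x * r (suc j)) n G)) cs
      ≈⟨ contract-row-op (- x) _ (λ j → +-congˡ (-‿distribˡ-* x (r j))) cs ⟩
    contract r (contract (shift r) (hankel (λ j → r (2 ℕ.+ j) - x * r (suc j)) n G)) cs
      ≈⟨ contract-cong (λ _ → refl) (hankel-step (shift r) x n G) cs ⟩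
    contract r (contract (shift r) (hankel (shift (shift r)) n G)) cs ∎

  hankel-cong : ∀ {r s G} n → (∀ j → r j ≈ s j) → ∀ cs → hankel r n G cs ≈ hankel s n G cs
  hankel-cong zero    r≈s cs = refl
  hankel-cong (suc n) r≈s cs = contract-cong r≈s (hankel-cong n (r≈s ∘ suc)) cs

  wedge-cong : ∀ {B : Set a} {s t : B → Row} {G} → (∀ y j → s y j ≈ t y j) → ∀ ys cs →
    wedge (map s ys) G cs ≈ wedge (map t ys) G cs
  wedge-cong s≈t []       cs = refl
  wedge-cong s≈t (y ∷ ys) cs = contract-cong (s≈t y) (wedge-cong s≈t ys) cs

  -- Row i < n and column c < N meet in the entry of index i + c ≤ n + N - 2; this is the bound
  -- `suc j < n + N`.
  hankel-cong-below : ∀ {r s G} n N → (∀ j → suc j ℕ.< n ℕ.+ N → r j ≈ s j) →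
    ∀ {cs} → All (ℕ._< N) cs → hankel r n G cs ≈ hankel s n G cs
  hankel-cong-below zero    N r≈s cs<N = refl
  hankel-cong-below (suc n) N r≈s cs<N = contract-cong-on
    (λ {c} c<N → r≈s c (s≤s (ℕ.≤-trans c<N (ℕ.m≤n+m N n))))
    (hankel-cong-below n N (λ j j<  → r≈s (suc j) (s≤s j<))) cs<N

  hankel-∣ : ∀ {d r} n N → (∀ j → suc j ℕ.< n ℕ.+ N → d ∣ r j) →
    ∀ {cs} → All (ℕ._< N) cs → d ^ n ∣ hankel r n unit cs
  hankel-∣ zero    N d∣r cs<N = 1∣ _
  hankel-∣ (suc n) N d∣r cs<N = contract-∣
    (λ {c} c<N → d∣r c (s≤s (ℕ.≤-trans c<N (ℕ.m≤n+m N n))))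
    (hankel-∣ n N (λ j j< → d∣r (suc j) (s≤s j<))) cs<N

  -- Exponential sums and the divisibility of their Hankel determinants.

  Exponentials : Set a
  Exponentials = List (Carrier × Carrier)

  expSum : Exponentials → Row
  expSum []            j = 0#
  expSum ((α , x) ∷ ν) j = α * x ^ j + expSum ν j

  -- The operator r ↦ shift r - x r acts on an exponential yʲ as multiplication by y - x.
  scale : Carrier → Exponentials → Exponentials
  scale x = map (λ (α , y) → α * (y - x) , y)

  expSum-scale : ∀ x ν j → expSum (scale x ν) j ≈ expSum ν (suc j) - x * expSum ν j
  expSum-scale x []            j = sym (trans (+-congˡ (-‿cong (zeroʳ x))) (-‿inverseʳ 0#))
  expSum-scale x ((α , y) ∷ ν) j = begin
    α * (y - x) * y ^ j + expSum (scale x ν) j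
      ≈⟨ +-congˡ (expSum-scale x ν j) ⟩
    α * (y - x) * y ^ j + (expSum ν (suc j) - x * expSum ν j)
      ≈⟨ solve 6 (λ α y x e s t → α :* (y :- x) :* e :+ (s :- x :* t) :=
                                  α :* (y :* e) :+ s :- x :* (α :* e :+ t)) refl α y x (y ^ j) _ _ ⟩
    α * (y * y ^ j) + expSum ν (suc j) - x * (α * y ^ j + expSum ν j) ∎

  expSum-∷-scale : ∀ α x ν j → expSum ((α , x) ∷ ν) (suc j) - x * expSum ((α , x) ∷ ν) j ≈
    expSum (scale x ν) j
  expSum-∷-scale α x ν j = begin
    α * (x * x ^ j) + expSum ν (suc j) - x * (α * x ^ j + expSum ν j)
      ≈⟨ solve 5 (λ α x e s t → α :* (x :* e) :+ s :- x :* (α :* e :+ t) := s :- x :* t)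
           refl α x (x ^ j) _ _ ⟩
    expSum ν (suc j) - x * expSum ν j
      ≈⟨ expSum-scale x ν j ⟨
    expSum (scale x ν) j ∎

  -- Each exponential costs one row: after `hankel-step` at its node the top row contributes only
  -- the divisor 1, and the rows below are congruent to a sum with one term fewer. Once no
  -- exponential is left, every remaining row is divisible by `d`.
  hankel-expSum-∣ : ∀ {d r} n N (ν : Exponentials) → length ν ℕ.≤ n →
    (∀ j → suc j ℕ.< n ℕ.+ N → d ∣ r j - expSum ν j) →
    ∀ {cs} → All (ℕ._< N) cs → d ^ (n ℕ.∸ length ν) ∣ hankel r n unit cs
  hankel-expSum-∣ {d} {r} n N [] _ d∣r cs<N = hankel-∣ n N
    (λ j j< → ∣-respʳ-≈ (solve 1 (λ x → x :- :0 := x) refl (r j)) (d∣r j j<)) cs<N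
  hankel-expSum-∣ {d} {r} (suc n) N ((α , x) ∷ ν) (s≤s ν≤n) d∣r {cs} cs<N =
    ∣-respˡ-≈ (*-identityˡ _) (∣-respʳ-≈ (hankel-step r x n unit cs)
      (contract-∣ (λ _ → 1∣ _) tail-∣ cs<N))
    where
    next : Row
    next j = r (suc j) - x * r j

    -- Entry j of the new sequence uses entries j and j + 1 of the old one; the row that was spent
    -- leaves exactly this room in the bound.
    congruent : ∀ j → suc j ℕ.< n ℕ.+ N → d ∣ next j - expSum (scale x ν) j
    congruent j j< = ∣-respʳ-≈
      (begin
        r (suc j) - expSum ((α , x) ∷ ν) (suc j) - x * (r j - expSum ((α , x) ∷ ν) j)
          ≈⟨ solve 5 (λ r′ s′ x r s → r′ :- s′ :- x :* (r :- s) := r′ :- x :* r :- (s′ :- x :* s))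
               refl (r (suc j)) _ x (r j) _ ⟩
        next j - (expSum ((α , x) ∷ ν) (suc j) - x * expSum ((α , x) ∷ ν) j)
          ≈⟨ +-congˡ (-‿cong (expSum-∷-scale α x ν j)) ⟩
        next j - expSum (scale x ν) j ∎)
      (∣-sub (d∣r (suc j) (s≤s j<)) (x∣ʳy⇒x∣ʳzy x (d∣r j (ℕ.m<n⇒m<1+n j<))))

    tail-∣ : ∀ {ds} → All (ℕ._< N) ds → d ^ (n ℕ.∸ length ν) ∣ hankel next n unit ds
    tail-∣ {ds} ds<N = ≡.subst (λ k → d ^ (n ℕ.∸ k) ∣ hankel next n unit ds)
      (length-map _ ν)
      (hankel-expSum-∣ n N (scale x ν) (≡.subst (ℕ._≤ n) (≡.sym (length-map _ ν)) ν≤n) congruent ds<N)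

-- Nonvanishing of Hankel and Vandermonde determinants without zero divisors.

module Nonvanishing {a b} (A : CommutativeRing a b)
  (1≉0 : CommutativeRing._≉_ A (CommutativeRing.1# A) (CommutativeRing.0# A))
  (*-≉0 : ∀ {x y} → CommutativeRing._≉_ A x (CommutativeRing.0# A) →
    CommutativeRing._≉_ A y (CommutativeRing.0# A) →
    CommutativeRing._≉_ A (CommutativeRing._*_ A x y) (CommutativeRing.0# A)) where

  open CommutativeRing A
  open IntegerSolver A
  open Contraction A
  open import Algebra.Properties.Ring ring using (-1*x≈-x; x∙y⁻¹≈ε⇒x≈y)
  open import Algebra.Properties.Semiring.Exp semiring using (_^_)
  open import Relation.Binary.Reasoning.Setoid setoid

  -- The orientation matches the factors y - x, in which x is the earlier node.
  Distinct : List Carrier → Set (a ⊔ b)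
  Distinct = AllPairs (λ x y → y ≉ x)

  difference≉0 : ∀ {x y} → y ≉ x → y - x ≉ 0#
  difference≉0 y≉x y-x≈0 = y≉x (x∙y⁻¹≈ε⇒x≈y _ _ y-x≈0)

  nodes : Exponentials → List Carrier
  nodes = map proj₂

  -- The repeated row is moved down by anticommutation until it meets its twin.
  contract-wedge-∈ : ∀ {xs x} (v : Carrier → Row) G → x ∈ xs →
    ∀ cs → contract (v x) (wedge (map v xs) G) cs ≈ 0#
  contract-wedge-∈ v G (here ≡.refl) cs = contract-square _ _ cs
  contract-wedge-∈ {y ∷ xs} {x} v G (there x∈xs) cs = begin
    contract (v x) (contract (v y) (wedge (map v xs) G)) cs
      ≈⟨ contract-anticomm (v x) (v y) _ cs ⟩
    - 1# * contract (v y) (contract (v x) (wedge (map v xs) G)) cs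
      ≈⟨ *-congˡ (contract-zero (v y) (contract-wedge-∈ v G x∈xs) cs) ⟩
    - 1# * 0#
      ≈⟨ zeroʳ _ ⟩
    0# ∎

  contract-expSum-wedge : ∀ {xs} ν G → All (_∈ xs) (nodes ν) →
    ∀ cs → contract (expSum ν) (wedge (map (λ x j → x ^ j) xs) G) cs ≈ 0#
  contract-expSum-wedge {xs} [] G [] cs = begin
    contract (λ _ → 0#) H cs
      ≈⟨ contract-row-linear 0# 0# H (λ _ → 0≈x*0+y*0 0# 0#) cs ⟩
    0# * contract (λ _ → 0#) H cs + 0# * contract (λ _ → 0#) H cs
      ≈⟨ trans (+-cong (zeroˡ _) (zeroˡ _)) (+-identityʳ 0#) ⟩
    0# ∎
    where H = wedge (map (λ x j → x ^ j) xs) G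
  contract-expSum-wedge {xs} ((α , y) ∷ ν) G (y∈xs ∷ ν⊆xs) cs = begin
    contract (expSum ((α , y) ∷ ν)) H cs
      ≈⟨ contract-row-linear α 1# H (λ j → +-congˡ (sym (*-identityˡ _))) cs ⟩
    α * contract (λ j → y ^ j) H cs + 1# * contract (expSum ν) H cs
      ≈⟨ +-cong (*-congˡ (contract-wedge-∈ (λ x j → x ^ j) G y∈xs cs))
           (*-congˡ (contract-expSum-wedge ν G ν⊆xs cs)) ⟩
    α * 0# + 1# * 0#
      ≈⟨ 0≈x*0+y*0 α 1# ⟨
    0# ∎
    where H = wedge (map (λ x j → x ^ j) xs) G

  nodes-scale : ∀ x ν → nodes (scale x ν) ≡ nodes ν
  nodes-scale x ν = ≡.sym (map-∘ ν)

  weights-scale-≉0 : ∀ x ν → All (λ y → y ≉ x) (nodes ν) → All (λ (α , _) → α ≉ 0#) ν →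
    All (λ (α , _) → α ≉ 0#) (scale x ν)
  weights-scale-≉0 x []            []         []         = []
  weights-scale-≉0 x ((α , y) ∷ ν) (y≉x ∷ ps) (α≉0 ∷ qs) =
    *-≉0 α≉0 (difference≉0 y≉x) ∷ weights-scale-≉0 x ν ps qs

  -- The Hankel matrix of an exponential sum is a diagonal matrix between two Vandermonde matrices.
  -- The factor k collects the weights and one Vandermonde determinant, as the factors y - x
  -- produced by `scale`; the other one stays as the wedge of the power rows.
  hankel-expSum : ∀ n ν G → length ν ≡ n → All (λ (α , _) → α ≉ 0#) ν → Distinct (nodes ν) →
    ∃[ k ] k ≉ 0# × (∀ cs → hankel (expSum ν) n G cs ≈ k * wedge (map (λ x j → x ^ j) (nodes ν)) G cs)
  hankel-expSum zero [] G _ _ _ = 1# , 1≉0 , λ cs → sym (*-identityˡ _)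
  hankel-expSum (suc n) ((α , x) ∷ ν) G |ν|≡ (α≉0 ∷ αs≉0) (x∉ ∷ distinct)
    with k , k≉0 , step ← hankel-expSum n (scale x ν) G
      (≡.trans (length-map _ ν) (ℕ.suc-injective |ν|≡))
      (weights-scale-≉0 x ν x∉ αs≉0)
      (≡.subst Distinct (≡.sym (nodes-scale x ν)) distinct)
    = k * α , *-≉0 k≉0 α≉0 , reduce
    where
    r : Row
    r = expSum ((α , x) ∷ ν)

    W : Form
    W = wedge (map (λ x j → x ^ j) (nodes ν)) G

    reduce : ∀ cs → hankel r (suc n) G cs ≈ k * α * contract (λ j → x ^ j) W cs
    reduce cs = begin
      contract r (hankel (shift r) n G) cs
        ≈⟨ hankel-step r x n G cs ⟨
      contract r (hankel (λ j → r (suc j) - x * r j) n G) cs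
        ≈⟨ contract-cong (λ _ → refl) (λ ds → hankel-cong n (expSum-∷-scale α x ν) ds) cs ⟩
      contract r (hankel (expSum (scale x ν)) n G) cs
        ≈⟨ contract-linear {K = λ _ → 0#} r k 0# (λ ds →
             trans (step ds) (sym (trans (+-congˡ (zeroˡ 0#)) (+-identityʳ _)))) cs ⟩
      k * contract r (wedge (map (λ x j → x ^ j) (nodes (scale x ν))) G) cs + 0# * contract r (λ _ → 0#) cs
        ≈⟨ trans (+-congˡ (zeroˡ _)) (+-identityʳ _) ⟩
      k * contract r (wedge (map (λ x j → x ^ j) (nodes (scale x ν))) G) cs
        ≡⟨ ≡.cong (λ ys → k * contract r (wedge (map (λ x j → x ^ j) ys) G) cs) (nodes-scale x ν) ⟩
      k * contract r W cs
        ≈⟨ *-congˡ (contract-row-linear α 1# W (λ j → +-congˡ (sym (*-identityˡ _))) cs) ⟩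
      -- Of the first row only the exponential of x survives: the others are multiples of power rows
      -- already present in `W`.
      k * (α * contract (λ j → x ^ j) W cs + 1# * contract (expSum ν) W cs)
        ≈⟨ *-congˡ (+-congˡ (trans (*-congˡ (contract-expSum-wedge ν G (All.tabulate id) cs)) (zeroʳ 1#))) ⟩
      k * (α * contract (λ j → x ^ j) W cs + 0#)
        ≈⟨ *-congˡ (+-identityʳ _) ⟩
      k * (α * contract (λ j → x ^ j) W cs)
        ≈⟨ *-assoc k α _ ⟨
      k * α * contract (λ j → x ^ j) W cs ∎

  -- The row `r` is carried past each row after changing it, so that it stands directly above the
  -- next one, and is then carried back.
  contract-wedge-op : ∀ {B : Set a} (r : Row) (s t : B → Row) (x : B → Carrier) →
    (∀ y j → t y j ≈ s y j + x y * r j) → ∀ ys G cs →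
    contract r (wedge (map t ys) G) cs ≈ contract r (wedge (map s ys) G) cs
  contract-wedge-op r s t x t≈ []       G cs = refl
  contract-wedge-op r s t x t≈ (y ∷ ys) G cs = begin
    contract r (contract (t y) (wedge (map t ys) G)) cs
      ≈⟨ contract-row-op (x y) _ (t≈ y) cs ⟩
    contract r (contract (s y) (wedge (map t ys) G)) cs
      ≈⟨ contract-anticomm r (s y) _ cs ⟩
    - 1# * contract (s y) (contract r (wedge (map t ys) G)) cs
      ≈⟨ *-congˡ (contract-cong (λ _ → refl) (contract-wedge-op r s t x t≈ ys G) cs) ⟩
    - 1# * contract (s y) (contract r (wedge (map s ys) G)) cs
      ≈⟨ contract-anticomm r (s y) _ cs ⟨
    contract r (contract (s y) (wedge (map s ys) G)) cs ∎

  wedge-vanish-0 : ∀ {B : Set a} (t : B → Row) → (∀ y → t y 0 ≈ 0#) →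
    ∀ ys cs → wedge (map t ys) unit (0 ∷ cs) ≈ 0#
  wedge-vanish-0 t t≈0 []       cs = refl
  wedge-vanish-0 t t≈0 (y ∷ ys) cs = begin
    t y 0 * wedge (map t ys) unit cs - contract (t y) (λ ds → wedge (map t ys) unit (0 ∷ ds)) cs
      ≈⟨ +-cong (*-congʳ (t≈0 y)) (-‿cong (contract-zero (t y) (wedge-vanish-0 t t≈0 ys) cs)) ⟩
    0# * wedge (map t ys) unit cs - 0#
      ≈⟨ solve 1 (λ x → :0 :* x :- :0 := :0) refl _ ⟩
    0# ∎

  contract-shift : ∀ r G cs → contract r G (map suc cs) ≈ contract (shift r) (G ∘ map suc) cs
  contract-shift r G []       = refl
  contract-shift r G (c ∷ cs) = +-congˡ (-‿cong (contract-shift r (G ∘ (suc c ∷_)) cs))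

  wedge-shift : ∀ {B : Set a} (t : B → Row) ys cs →
    wedge (map t ys) unit (map suc cs) ≈ wedge (map (shift ∘ t) ys) unit cs
  wedge-shift t []       []       = refl
  wedge-shift t []       (_ ∷ _)  = refl
  wedge-shift t (y ∷ ys) cs       = trans (contract-shift (t y) _ cs)
    (contract-cong (λ _ → refl) (wedge-shift t ys) cs)

  wedge-scale : ∀ (k : Carrier → Carrier) (t : Carrier → Row) ys → All (λ y → k y ≉ 0#) ys →
    ∃[ x ] x ≉ 0# × (∀ cs → wedge (map (λ y j → k y * t y j) ys) unit cs ≈ x * wedge (map t ys) unit cs)
  wedge-scale k t []       []           = 1# , 1≉0 , λ cs → sym (*-identityˡ _)
  wedge-scale k t (y ∷ ys) (ky≉0 ∷ ≉0) with x , x≉0 , step ← wedge-scale k t ys ≉0 =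
    k y * x , *-≉0 ky≉0 x≉0 , λ cs → begin
      contract (λ j → k y * t y j) (wedge (map (λ y j → k y * t y j) ys) unit) cs
        ≈⟨ contract-row-linear (k y) 0# _ (λ j → x≈x+0*z _ (t y j)) cs ⟩
      k y * contract (t y) (wedge (map (λ y j → k y * t y j) ys) unit) cs + 0# * _
        ≈⟨ x≈x+0*z _ _ ⟨
      k y * contract (t y) (wedge (map (λ y j → k y * t y j) ys) unit) cs
        ≈⟨ *-congˡ (contract-linear {K = λ _ → 0#} (t y) x 0# (λ ds → trans (step ds) (x≈x+0*z _ _)) cs) ⟩
      k y * (x * contract (t y) (wedge (map t ys) unit) cs + 0# * _)
        ≈⟨ *-congˡ (x≈x+0*z _ _) ⟨
      k y * (x * contract (t y) (wedge (map t ys) unit) cs)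
        ≈⟨ *-assoc _ _ _ ⟨
      k y * x * contract (t y) (wedge (map t ys) unit) cs ∎
    where
    x≈x+0*z : ∀ x z → x ≈ x + 0# * z
    x≈x+0*z x z = sym (trans (+-congˡ (zeroˡ z)) (+-identityʳ x))

  -- If u has generating function u(t), then geometric x u has u(t) / (1 - x t),
  -- so the differences of these rows are again of this form.
  geometric : Carrier → Row → Row
  geometric x u zero    = u 0
  geometric x u (suc j) = x * geometric x u j + u (suc j)

  geometric-difference : ∀ x y u j → geometric y u (suc j) - geometric x u (suc j) ≈
    (y - x) * geometric y (geometric x u) j
  geometric-difference x y u zero =
    solve 4 (λ x y u v → y :* u :+ v :- (x :* u :+ v) := (y :- x) :* u) refl x y (u 0) (u 1)
  geometric-difference x y u (suc j) = begin
    y * g + u (2 ℕ.+ j) - (x * h + u (2 ℕ.+ j))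
      ≈⟨ solve 5 (λ x y g h u → y :* g :+ u :- (x :* h :+ u) := y :* (g :- h) :+ (y :- x) :* h)
           refl x y g h (u (2 ℕ.+ j)) ⟩
    y * (g - h) + (y - x) * h
      ≈⟨ +-congʳ (*-congˡ (geometric-difference x y u j)) ⟩
    y * ((y - x) * k) + (y - x) * h
      ≈⟨ solve 4 (λ x y k h → y :* ((y :- x) :* k) :+ (y :- x) :* h := (y :- x) :* (y :* k :+ h))
           refl x y k h ⟩
    (y - x) * (y * k + h) ∎
    where
    g = geometric y u (suc j)
    h = geometric x u (suc j)
    k = geometric y (geometric x u) j

  -- The seed `u` is arbitrary so that the induction closes. Subtracting the first row clears column
  -- 0 below `u 0`, and taking y - x out of the row of y leaves the same kind of matrix with seed
  -- `geometric x u`, whose value at 0 is again `u 0`.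
  vandermonde : ∀ u xs → u 0 ≉ 0# → Distinct xs →
    wedge (map (λ x → geometric x u) xs) unit (upTo (length xs)) ≉ 0#
  vandermonde u [] u≉0 [] = 1≉0
  vandermonde u (x ∷ xs) u≉0 (x∉ ∷ distinct)
    with k , k≉0 , scaled ← wedge-scale (λ y → y - x) (λ y → geometric y (geometric x u)) xs
                              (All.map difference≉0 x∉)
    = λ det≈0 → *-≉0 u≉0 (*-≉0 k≉0 (vandermonde (geometric x u) xs u≉0 distinct))
        (trans (sym expand) det≈0)
    where
    n = length xs

    δ : Carrier → Row
    δ y j = geometric y u j - geometric x u j

    expand : wedge (map (λ y → geometric y u) (x ∷ xs)) unit (upTo (suc n)) ≈
      u 0 * (k * wedge (map (λ y → geometric y (geometric x u)) xs) unit (upTo n))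
    expand = begin
      contract (geometric x u) (wedge (map (λ y → geometric y u) xs) unit) (upTo (suc n))
        ≈⟨ contract-wedge-op (geometric x u) (λ y → geometric y u) δ (λ _ → - 1#)
             (λ y j → +-congˡ (sym (-1*x≈-x _))) xs unit (upTo (suc n)) ⟨
      contract (geometric x u) (wedge (map δ xs) unit) (0 ∷ applyUpTo suc n)
        ≈⟨ +-congˡ (-‿cong (contract-zero (geometric x u)
             (wedge-vanish-0 δ (λ _ → -‿inverseʳ (u 0)) xs) (applyUpTo suc n))) ⟩
      u 0 * wedge (map δ xs) unit (applyUpTo suc n) - 0#
        ≈⟨ solve 1 (λ x → x :- :0 := x) refl _ ⟩
      u 0 * wedge (map δ xs) unit (applyUpTo suc n)
        ≡⟨ ≡.cong (λ cs → u 0 * wedge (map δ xs) unit cs) (map-upTo suc n) ⟨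
      u 0 * wedge (map δ xs) unit (map suc (upTo n))
        ≈⟨ *-congˡ (wedge-shift δ xs (upTo n)) ⟩
      u 0 * wedge (map (shift ∘ δ) xs) unit (upTo n)
        ≈⟨ *-congˡ (wedge-cong (λ y → geometric-difference x y u) xs (upTo n)) ⟩
      u 0 * wedge (map (λ y j → (y - x) * geometric y (geometric x u) j) xs) unit (upTo n)
        ≈⟨ *-congˡ (scaled (upTo n)) ⟩
      u 0 * (k * wedge (map (λ y → geometric y (geometric x u)) xs) unit (upTo n)) ∎

  hankel-expSum-≉0 : ∀ n ν → length ν ≡ n → All (λ (α , _) → α ≉ 0#) ν → Distinct (nodes ν) →
    hankel (expSum ν) n unit (upTo n) ≉ 0#
  hankel-expSum-≉0 n ν |ν|≡n α≉0 distinct with k , k≉0 , eq ← hankel-expSum n ν unit |ν|≡n α≉0 distinct =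
    λ det≈0 → *-≉0 k≉0 (vandermonde impulse (nodes ν) 1≉0 distinct) (begin
      k * wedge (map (λ x → geometric x impulse) (nodes ν)) unit (upTo (length (nodes ν)))
        ≈⟨ *-congˡ (wedge-cong geometric-impulse (nodes ν) _) ⟩
      k * wedge (map (λ x j → x ^ j) (nodes ν)) unit (upTo (length (nodes ν)))
        ≡⟨ ≡.cong (λ m → k * wedge (map (λ x j → x ^ j) (nodes ν)) unit (upTo m))
             (≡.trans (length-map proj₂ ν) |ν|≡n) ⟩
      k * wedge (map (λ x j → x ^ j) (nodes ν)) unit (upTo n)
        ≈⟨ eq (upTo n) ⟨
      hankel (expSum ν) n unit (upTo n)
        ≈⟨ det≈0 ⟩
      0# ∎)
    where
    -- The seed with generating function 1, for which the geometric rows are the plain powers.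
    impulse : Row
    impulse zero    = 1#
    impulse (suc _) = 0#

    geometric-impulse : ∀ x j → geometric x impulse j ≈ x ^ j
    geometric-impulse x zero    = refl
    geometric-impulse x (suc j) = trans (+-identityʳ _) (*-congˡ (geometric-impulse x j))

-- Transfer along ring homomorphisms, and exchange of exponential sums with equal power sums.

module Homomorphism {a b a′ b′} (A : CommutativeRing a b) (B : CommutativeRing a′ b′)
  {h : CommutativeRing.Carrier A → CommutativeRing.Carrier B}
  (isHom : RingMorphisms.IsRingHomomorphism (CommutativeRing.rawRing A) (CommutativeRing.rawRing B) h) where

  private module A = CommutativeRing A
  open CommutativeRing B
  open RingMorphisms.IsRingHomomorphism isHom
  open IntegerSolver B
  open import Algebra.Properties.Ring ring using (-1*x≈-x)
  open import Algebra.Properties.Semiring.Exp semiring using (_^_)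
  open import Algebra.Properties.CommutativeSemiring.Exp commutativeSemiring using (^-distrib-*)
  open import Algebra.Properties.CommutativeSemigroup.Divisibility *-commutativeSemigroup
    using (_∣_; ∣-respʳ-≈; x∣ʳy⇒x∣ʳzy)
  open import Algebra.Properties.Semiring.Divisibility semiring using (_∣0)
  open import Relation.Binary.Reasoning.Setoid setoid
  open import Algebra.Properties.Semiring.Exp A.semiring using () renaming (_^_ to _^ᴬ_)
  private module A-Contraction = Contraction A
  open Contraction B

  homo-^ : ∀ x n → h (x ^ᴬ n) ≈ h x ^ n
  homo-^ x zero    = 1#-homo
  homo-^ x (suc n) = trans (*-homo x _) (*-congˡ (homo-^ x n))

  homo-contract : ∀ {r s G H} → (∀ c → h (r c) ≈ s c) → (∀ cs → h (G cs) ≈ H cs) →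
    ∀ cs → h (A-Contraction.contract r G cs) ≈ contract s H cs
  homo-contract r≈s G≈H []       = 0#-homo
  homo-contract r≈s G≈H (c ∷ cs) = trans (+-homo _ _) (+-cong
    (trans (*-homo _ _) (*-cong (r≈s c) (G≈H cs)))
    (trans (-‿homo _) (-‿cong (homo-contract r≈s (λ ds → G≈H (c ∷ ds)) cs))))

  homo-hankel : ∀ {r s} n → (∀ j → h (r j) ≈ s j) →
    ∀ cs → h (A-Contraction.hankel r n A-Contraction.unit cs) ≈ hankel s n unit cs
  homo-hankel zero    r≈s []       = 1#-homo
  homo-hankel zero    r≈s (_ ∷ _)  = 0#-homo
  homo-hankel (suc n) r≈s cs       = homo-contract r≈s (homo-hankel n (r≈s ∘ suc)) cs

  homo-expSum : ∀ {P : Set} (α x : P → A.Carrier) (β y : P → Carrier) →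
    (∀ t → h (α t) ≈ β t) → (∀ t → h (x t) ≈ y t) → ∀ T j →
    h (A-Contraction.expSum (map (λ t → α t , x t) T) j) ≈ expSum (map (λ t → β t , y t) T) j
  homo-expSum α x β y α≈β x≈y []      j = 0#-homo
  homo-expSum α x β y α≈β x≈y (t ∷ T) j = trans (+-homo _ _) (+-cong
    (trans (*-homo _ _) (*-cong (α≈β t) (trans (homo-^ (x t) j) (^-congˡ j (x≈y t)))))
    (homo-expSum α x β y α≈β x≈y T j))
    where open import Algebra.Properties.Semiring.Exp semiring using (^-congˡ)

  -- If a sequence is given by terms z ^ j * (ω - z) with z = h c * τ, it is
  -- determined by the power sums of the c, whichever weighted nodes these are
  -- computed from.
  twist : Carrier → Carrier → A-Contraction.Exponentials → Exponentials
  twist ω τ = map (λ (w , c) → h w * (ω - h c * τ) , h c * τ)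

  -- For z = h c τ the term zʲ (ω - z) is ω τʲ cʲ - τʲ⁺¹ cʲ⁺¹, with c read through h. So entry j
  -- needs two consecutive power sums, j and j + 1.
  expSum-twist : ∀ ω τ μ j → expSum (twist ω τ μ) j ≈
    ω * (τ ^ j * h (A-Contraction.expSum μ j)) - τ ^ suc j * h (A-Contraction.expSum μ (suc j))
  expSum-twist ω τ [] j = begin
    0#
      ≈⟨ solve 3 (λ o t u → o :* (t :* :0) :- u :* :0 := :0) refl ω (τ ^ j) (τ ^ suc j) ⟨
    ω * (τ ^ j * 0#) - τ ^ suc j * 0#
      ≈⟨ +-cong (*-congˡ (*-congˡ 0#-homo)) (-‿cong (*-congˡ 0#-homo)) ⟨
    ω * (τ ^ j * h A.0#) - τ ^ suc j * h A.0# ∎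
  expSum-twist ω τ ((w , c) ∷ μ) j = begin
    h w * (ω - h c * τ) * (h c * τ) ^ j + expSum (twist ω τ μ) j
      ≈⟨ +-cong (*-congˡ (^-distrib-* (h c) τ j)) (expSum-twist ω τ μ j) ⟩
    h w * (ω - h c * τ) * (h c ^ j * τ ^ j) + (ω * (τ ^ j * s) - τ ^ suc j * s′)
      ≈⟨ solve 8 (λ w o c t e f s s′ → w :* (o :- c :* t) :* (e :* f) :+ (o :* (f :* s) :- t :* f :* s′) :=
                    o :* (f :* (w :* e :+ s)) :- t :* f :* (w :* (c :* e) :+ s′))
           refl (h w) ω (h c) τ (h c ^ j) (τ ^ j) s s′ ⟩
    ω * (τ ^ j * (h w * h c ^ j + s)) - τ ^ suc j * (h w * h c ^ suc j + s′)
      ≈⟨ +-cong (*-congˡ (*-congˡ (homo-term j))) (-‿cong (*-congˡ (homo-term (suc j)))) ⟨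
    ω * (τ ^ j * h (A-Contraction.expSum ((w , c) ∷ μ) j))
      - τ ^ suc j * h (A-Contraction.expSum ((w , c) ∷ μ) (suc j)) ∎
    where
    s  = h (A-Contraction.expSum μ j)
    s′ = h (A-Contraction.expSum μ (suc j))

    homo-term : ∀ i → h (A-Contraction.expSum ((w , c) ∷ μ) i) ≈ h w * h c ^ i + h (A-Contraction.expSum μ i)
    homo-term i = trans (+-homo _ _) (+-congʳ (trans (*-homo _ _) (*-congˡ (homo-^ c i))))

  ∣-^-difference : ∀ {d x y} j → d ∣ x - y → d ∣ x ^ j - y ^ j
  ∣-^-difference zero    d∣ = ∣-respʳ-≈ (sym (-‿inverseʳ 1#)) (_ ∣0)
  ∣-^-difference {d} {x} {y} (suc j) d∣ = ∣-respʳ-≈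
    (solve 4 (λ x y u v → x :* (u :- v) :- (:- v) :* (x :- y) := x :* u :- y :* v) refl x y (x ^ j) (y ^ j))
    (∣-sub (x∣ʳy⇒x∣ʳzy x (∣-^-difference j d∣)) (x∣ʳy⇒x∣ʳzy (- (y ^ j)) d∣))

  ∣-expSum-difference : ∀ {P : Set} {d ω τ} (z : P → Carrier) (ζ : P → A.Carrier) →
    (∀ t → d ∣ z t - h (ζ t) * τ) → ∀ T j →
    d ∣ expSum (map (λ t → ω - z t , z t) T) j - expSum (twist ω τ (map (λ t → A.1# , ζ t) T)) j
  ∣-expSum-difference z ζ d∣ []      j = ∣-respʳ-≈ (sym (-‿inverseʳ 0#)) (_ ∣0)
  ∣-expSum-difference {d = d} {ω} {τ} z ζ d∣ (t ∷ T) j = ∣-respʳ-≈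
    (begin
      -- For z = `z t` the change in one term is (ω - z) zʲ - (ω - y) yʲ = ω (zʲ - yʲ) - (zʲ⁺¹ -
      -- yʲ⁺¹), a combination of differences of powers.
      s - s′ - (- 1# * (ω * (z t ^ j - y ^ j) - (z t ^ suc j - y ^ suc j)))
        ≈⟨ solve 7 (λ s s′ o z y u v → s :- s′ :- (:- :1 :* (o :* (u :- v) :- (z :* u :- y :* v))) :=
                     (o :- z) :* u :+ s :- (:1 :* (o :- y) :* v :+ s′))
             refl s s′ ω (z t) y (z t ^ j) (y ^ j) ⟩
      (ω - z t) * z t ^ j + s - (1# * (ω - y) * y ^ j + s′)
        ≈⟨ +-congˡ (-‿cong (+-congʳ (*-congʳ (*-congʳ 1#-homo)))) ⟨
      (ω - z t) * z t ^ j + s - (h A.1# * (ω - y) * y ^ j + s′) ∎)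
    (∣-sub (∣-expSum-difference z ζ d∣ T j) (x∣ʳy⇒x∣ʳzy (- 1#)
      (∣-sub (x∣ʳy⇒x∣ʳzy ω (∣-^-difference j (d∣ t))) (∣-^-difference (suc j) (d∣ t)))))
    where
    y  = h (ζ t) * τ
    s  = expSum (map (λ t → ω - z t , z t) T) j
    s′ = expSum (twist ω τ (map (λ t → A.1# , ζ t) T)) j

  -- Two replacements: modulo `d`, each `z t` becomes a scalar times τ; then, as an equality, the
  -- list `T` gives way to `μ`, which has the same power sums below `k`.
  ∣-expSum-twist : ∀ {P : Set} {d ω τ} (z : P → Carrier) (ζ : P → A.Carrier) →
    (∀ t → d ∣ z t - h (ζ t) * τ) → ∀ T μ k →
    (∀ j → j ℕ.< k → A-Contraction.expSum (map (λ t → A.1# , ζ t) T) j A.≈ A-Contraction.expSum μ j) →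
    ∀ j → suc j ℕ.< k → d ∣ expSum (map (λ t → ω - z t , z t) T) j - expSum (twist ω τ μ) j
  ∣-expSum-twist {d = d} {ω} {τ} z ζ d∣ T μ k T≈μ j j<k = ∣-respʳ-≈
    (+-congˡ (-‿cong (begin
      expSum (twist ω τ (map (λ t → A.1# , ζ t) T)) j
        ≈⟨ expSum-twist ω τ (map (λ t → A.1# , ζ t) T) j ⟩
      ω * (τ ^ j * h (A-Contraction.expSum (map (λ t → A.1# , ζ t) T) j))
        - τ ^ suc j * h (A-Contraction.expSum (map (λ t → A.1# , ζ t) T) (suc j))
        ≈⟨ +-cong (*-congˡ (*-congˡ (⟦⟧-cong (T≈μ j (ℕ.<⇒≤ j<k)))))
             (-‿cong (*-congˡ (⟦⟧-cong (T≈μ (suc j) j<k)))) ⟩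
      ω * (τ ^ j * h (A-Contraction.expSum μ j)) - τ ^ suc j * h (A-Contraction.expSum μ (suc j))
        ≈⟨ expSum-twist ω τ μ j ⟨
      expSum (twist ω τ μ) j ∎)))
    (∣-expSum-difference z ζ d∣ T j)

open ≡ using (refl; sym; trans; cong; cong₂; subst; module ≡-Reasoning)

-- Power sums over a finite field.

module FiniteFieldProperties {q : ℕ} (F : FiniteField q) where
  open FiniteField F using (commutativeRing; elements; enumeration; _≟_; 1≢0; invertible; _^_)
  open CommutativeRing commutativeRing hiding (refl; sym; trans; reflexive; zero; _≉_; _≈_)
  open IntegerSolver commutativeRing
  open import Algebra.Properties.Ring ring using (x∙y⁻¹≈ε⇒x≈y; +-cancelˡ)
  open import Algebra.Properties.Semiring.Mult semiring using (×1-homo-*; ×-homo-+) renaming (_×_ to _·_)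
  open import Algebra.Properties.CommutativeSemiring.Exp commutativeSemiring using (^-distrib-*)
  open ≡-Reasoning

  *-≢0 : ∀ {x y} → x ≢ 0# → y ≢ 0# → x * y ≢ 0#
  *-≢0 {x} {y} x≢0 y≢0 xy≡0 with x⁻¹ , xx⁻¹≡1 ← invertible x x≢0 = y≢0 (begin
    y                ≡⟨ *-identityˡ y ⟨
    1# * y           ≡⟨ cong (_* y) xx⁻¹≡1 ⟨
    x * x⁻¹ * y      ≡⟨ solve 3 (λ x z y → x :* z :* y := z :* (x :* y)) refl x x⁻¹ y ⟩
    x⁻¹ * (x * y)    ≡⟨ cong (x⁻¹ *_) xy≡0 ⟩
    x⁻¹ * 0#         ≡⟨ zeroʳ x⁻¹ ⟩
    0#               ∎)

  ∈-elements : ∀ x → x ∈ elements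
  ∈-elements x = subst (_∈ elements) (Inverse.strictlyInverseˡ enumeration x)
    (∈-map⁺ (Inverse.to enumeration) (∈-allFin (Inverse.from enumeration x)))

  elements-unique : Unique elements
  elements-unique = map⁺ (Injection.injective (↔⇒↣ enumeration)) (allFin⁺ q)

  length-elements : length elements ≡ q
  length-elements = trans (length-map _ (allFin q)) (length-tabulate id)

  ∑ : ∀ {B : Set} → List B → (B → Carrier) → Carrier
  ∑ xs f = foldr (λ x s → f x + s) 0# xs

  module _ {B : Set} where
    ∑-cong : ∀ {f g} (xs : List B) → (∀ x → f x ≡ g x) → ∑ xs f ≡ ∑ xs g
    ∑-cong []       f≡g = refl
    ∑-cong (x ∷ xs) f≡g = cong₂ _+_ (f≡g x) (∑-cong xs f≡g)

    ∑-+ : ∀ f g (xs : List B) → ∑ xs (λ x → f x + g x) ≡ ∑ xs f + ∑ xs g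
    ∑-+ f g []       = sym (+-identityʳ 0#)
    ∑-+ f g (x ∷ xs) = trans (cong (f x + g x +_) (∑-+ f g xs))
      (solve 4 (λ a b c d → a :+ b :+ (c :+ d) := a :+ c :+ (b :+ d)) refl (f x) (g x) _ _)

    ∑-*ˡ : ∀ k f (xs : List B) → ∑ xs (λ x → k * f x) ≡ k * ∑ xs f
    ∑-*ˡ k f []       = sym (zeroʳ k)
    ∑-*ˡ k f (x ∷ xs) = trans (cong (k * f x +_) (∑-*ˡ k f xs)) (sym (distribˡ k _ _))

    ∑-0 : ∀ (xs : List B) → ∑ xs (λ _ → 0#) ≡ 0#
    ∑-0 []       = refl
    ∑-0 (x ∷ xs) = trans (+-identityˡ _) (∑-0 xs)

    ∑-1 : ∀ (xs : List B) → ∑ xs (λ _ → 1#) ≡ length xs · 1#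
    ∑-1 []       = refl
    ∑-1 (x ∷ xs) = cong (1# +_) (∑-1 xs)

  ∑-swap : ∀ {B C : Set} (f : B → C → Carrier) xs ys →
    ∑ xs (λ x → ∑ ys (f x)) ≡ ∑ ys (λ y → ∑ xs (λ x → f x y))
  ∑-swap f []       ys = sym (∑-0 ys)
  ∑-swap f (x ∷ xs) ys = trans (cong (∑ ys (f x) +_) (∑-swap f xs ys)) (sym (∑-+ _ _ ys))

  indicator : ∀ {P : Set} → Dec P → Carrier
  indicator (yes _) = 1#
  indicator (no _)  = 0#

  indicator-⇔ : ∀ {P Q : Set} (P? : Dec P) (Q? : Dec Q) → (P → Q) → (Q → P) →
    indicator P? ≡ indicator Q?
  indicator-⇔ (yes p) (yes q) P⇒Q Q⇒P = refl
  indicator-⇔ (yes p) (no ¬q) P⇒Q Q⇒P = contradiction (P⇒Q p) ¬q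
  indicator-⇔ (no ¬p) (yes q) P⇒Q Q⇒P = contradiction (Q⇒P q) ¬p
  indicator-⇔ (no ¬p) (no ¬q) P⇒Q Q⇒P = refl

  ∑-indicator-∉ : ∀ {xs} a (f : Carrier → Carrier) → All (a ≢_) xs →
    ∑ xs (λ x → indicator (x ≟ a) * f x) ≡ 0#
  ∑-indicator-∉ a f [] = refl
  ∑-indicator-∉ {x ∷ xs} a f (a≢x ∷ a∉xs) with x ≟ a
  ... | yes x≡a = contradiction (sym x≡a) a≢x
  ... | no _    = trans (cong₂ _+_ (zeroˡ (f x)) (∑-indicator-∉ a f a∉xs)) (+-identityʳ 0#)

  ∑-indicator-∈ : ∀ {xs} a (f : Carrier → Carrier) → Unique xs → a ∈ xs →
    ∑ xs (λ x → indicator (x ≟ a) * f x) ≡ f a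
  ∑-indicator-∈ {x ∷ xs} a f (x∉xs ∷ xs!) a∈ with x ≟ a
  ... | yes refl = trans (cong₂ _+_ (*-identityˡ (f x)) (∑-indicator-∉ x f x∉xs)) (+-identityʳ (f x))
  ... | no x≢a   = trans
    (cong₂ _+_ (zeroˡ (f x)) (∑-indicator-∈ a f xs! (Any.tail (x≢a ∘ sym) a∈)))
    (+-identityˡ (f a))

  ∑-indicator : ∀ a (f : Carrier → Carrier) → ∑ elements (λ x → indicator (x ≟ a) * f x) ≡ f a
  ∑-indicator a f = ∑-indicator-∈ a f elements-unique (∈-elements a)

  -- Each f (σ x) is written as a sum over y of indicators of y = σ x; after exchanging the sums,
  -- the indicators of x = τ y pick out one x for every y. No permutation of the enumeration has to
  -- be constructed.
  ∑-bijection : ∀ (σ τ : Carrier → Carrier) → (∀ x → σ (τ x) ≡ x) → (∀ x → τ (σ x) ≡ x) →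
    ∀ (f : Carrier → Carrier) → ∑ elements (f ∘ σ) ≡ ∑ elements f
  ∑-bijection σ τ στ τσ f = begin
    ∑ elements (λ x → f (σ x))
      ≡⟨ ∑-cong elements (λ x → sym (∑-indicator (σ x) f)) ⟩
    ∑ elements (λ x → ∑ elements (λ y → indicator (y ≟ σ x) * f y))
      ≡⟨ ∑-swap _ elements elements ⟩
    ∑ elements (λ y → ∑ elements (λ x → indicator (y ≟ σ x) * f y))
      ≡⟨ ∑-cong elements (λ y → ∑-cong elements (λ x → cong (_* f y)
           (indicator-⇔ (y ≟ σ x) (x ≟ τ y)
             (λ y≡σx → sym (trans (cong τ y≡σx) (τσ x)))
             (λ x≡τy → sym (trans (cong σ x≡τy) (στ y)))))) ⟩
    ∑ elements (λ y → ∑ elements (λ x → indicator (x ≟ τ y) * f y))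
      ≡⟨ ∑-cong elements (λ y → ∑-indicator (τ y) (λ _ → f y)) ⟩
    ∑ elements f ∎

  -- The translation x ↦ x + 1 fixes the sum of all elements and adds q · 1 to it.
  q·1≡0 : q · 1# ≡ 0#
  q·1≡0 = +-cancelˡ (∑ elements id) (q · 1#) 0# (begin
    ∑ elements id + q · 1#                        ≡⟨ cong (λ n → ∑ elements id + n · 1#) length-elements ⟨
    ∑ elements id + length elements · 1#          ≡⟨ cong (∑ elements id +_) (∑-1 elements) ⟨
    ∑ elements id + ∑ elements (λ _ → 1#)         ≡⟨ ∑-+ id (λ _ → 1#) elements ⟨
    ∑ elements (λ x → x + 1#)                     ≡⟨ ∑-bijection (_+ 1#) (_- 1#)
                                                       (λ x → solve 2 (λ x y → x :- y :+ y := x) refl x 1#)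
                                                       (λ x → solve 2 (λ x y → x :+ y :- y := x) refl x 1#) id ⟩
    ∑ elements id                                 ≡⟨ +-identityʳ _ ⟨
    ∑ elements id + 0#                            ∎)

  -- The list holds the coefficients below the leading 1, lowest first: its length is the degree,
  -- and the zero polynomial is excluded.
  evalMonic : List Carrier → Carrier → Carrier
  evalMonic as x = foldr (λ a s → a + x * s) 1# as

  -- Synthetic division: the coefficients of (f(X) - f(r)) / (X - r) are the Horner values of the
  -- tails of f at r. The last of them is the leading 1, which is left out.
  divideMonic : Carrier → List Carrier → List Carrier
  divideMonic r []             = []
  divideMonic r (a ∷ [])       = []
  divideMonic r (a ∷ as@(_ ∷ _)) = evalMonic as r ∷ divideMonic r as

  evalMonic-divide : ∀ r a as x → evalMonic (a ∷ as) x - evalMonic (a ∷ as) r ≡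
    (x - r) * evalMonic (divideMonic r (a ∷ as)) x
  evalMonic-divide r a []       x =
    solve 4 (λ a x r e → a :+ x :* e :- (a :+ r :* e) := (x :- r) :* e) refl a x r 1#
  evalMonic-divide r a (b ∷ as) x = begin
    a + x * g - (a + r * h)
      ≡⟨ solve 5 (λ a x r g h → a :+ x :* g :- (a :+ r :* h) := (x :- r) :* h :+ x :* (g :- h))
           refl a x r g h ⟩
    (x - r) * h + x * (g - h)
      ≡⟨ cong (λ y → (x - r) * h + x * y) (evalMonic-divide r b as x) ⟩
    (x - r) * h + x * ((x - r) * k)
      ≡⟨ solve 4 (λ x r h k → (x :- r) :* h :+ x :* ((x :- r) :* k) := (x :- r) :* (h :+ x :* k))
           refl x r h k ⟩
    (x - r) * (h + x * k) ∎
    where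
    g = evalMonic (b ∷ as) x
    h = evalMonic (b ∷ as) r
    k = evalMonic (divideMonic r (b ∷ as)) x

  length-divideMonic : ∀ r a as → length (divideMonic r (a ∷ as)) ≡ length as
  length-divideMonic r a []       = refl
  length-divideMonic r a (b ∷ as) = cong suc (length-divideMonic r b as)

  roots-bound : ∀ n as xs → length as ≡ n → Unique xs → All (λ x → evalMonic as x ≡ 0#) xs →
    length xs ℕ.≤ n
  roots-bound n as       []       _     _            _ = z≤n
  roots-bound n []       (x ∷ xs) _     _            (1≡0 ∷ _) = contradiction 1≡0 1≢0
  roots-bound (suc n) (a ∷ as) (r ∷ xs) |as|≡ (r∉xs ∷ xs!) (r-root ∷ roots) =
    s≤s (roots-bound n (divideMonic r (a ∷ as)) xs
      (trans (length-divideMonic r a as) (ℕ.suc-injective |as|≡)) xs!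
      (All.zipWith root (r∉xs , roots)))
    where
    root : ∀ {x} → r ≢ x × evalMonic (a ∷ as) x ≡ 0# → evalMonic (divideMonic r (a ∷ as)) x ≡ 0#
    root {x} (r≢x , x-root) with evalMonic (divideMonic r (a ∷ as)) x ≟ 0#
    ... | yes ≡0 = ≡0
    ... | no ≢0  = contradiction
      (trans (sym (evalMonic-divide r a as x))
        (trans (cong₂ _-_ x-root r-root) (-‿inverseʳ 0#)))
      (*-≢0 (λ x-r≡0 → r≢x (sym (x∙y⁻¹≈ε⇒x≈y x r x-r≡0))) ≢0)

  evalMonic-zeros : ∀ n x → evalMonic (replicate n 0#) x ≡ x ^ n
  evalMonic-zeros zero    x = refl
  evalMonic-zeros (suc n) x = trans (+-identityˡ _) (cong (x *_) (evalMonic-zeros n x))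

  -- Otherwise all q elements would be roots of X^(k+2) - X, whose degree is below q.
  ∃-non-root-of-unity : ∀ k → 2 ℕ.+ k ℕ.< q → ∃[ g ] g ≢ 0# × g ^ suc k ≢ 1#
  ∃-non-root-of-unity k k<q with Any.any? (λ x → ¬? (x ≟ 0#) ×-dec ¬? (x ^ suc k ≟ 1#)) elements
  ... | yes ∃g = Any.satisfied ∃g
  ... | no ∄g  = contradiction (subst (ℕ._≤ 2 ℕ.+ k) length-elements
      (roots-bound (2 ℕ.+ k) coefficients elements (cong (2 ℕ.+_) (length-replicate k)) elements-unique
        (All.tabulate (λ {x} _ → root x))))
      (ℕ.<⇒≱ k<q)
    where
    coefficients : List Carrier
    coefficients = 0# ∷ - 1# ∷ replicate k 0#

    root : ∀ x → evalMonic coefficients x ≡ 0#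
    root x with x ≟ 0# | x ^ suc k ≟ 1#
    ... | yes refl | _ = trans (+-identityˡ _) (zeroˡ _)
    ... | no x≢0 | no ≢1 = contradiction
      (Any.map (λ { refl → x≢0 , ≢1 }) (∈-elements x)) ∄g
    ... | no _ | yes ≡1 = begin
      0# + x * (- 1# + x * evalMonic (replicate k 0#) x)
        ≡⟨ cong (λ y → 0# + x * (- 1# + x * y)) (evalMonic-zeros k x) ⟩
      0# + x * (- 1# + x ^ suc k)
        ≡⟨ cong (λ y → 0# + x * (- 1# + y)) ≡1 ⟩
      0# + x * (- 1# + 1#)
        ≡⟨ trans (+-identityˡ _) (trans (cong (x *_) (-‿inverseˡ 1#)) (zeroʳ x)) ⟩
      0# ∎

  -- For exponent 0 the sum counts the q elements. For a positive exponent the substitution x ↦ g x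
  -- multiplies the sum by a power of g that is not 1, yet only permutes its terms.
  power-sum-vanishes : ∀ k → suc k ℕ.< q → ∑ elements (_^ k) ≡ 0#
  power-sum-vanishes zero    _   = trans (∑-1 elements) (trans (cong (_· 1#) length-elements) q·1≡0)
  power-sum-vanishes (suc k) k<q
    with g , g≢0 , gᵏ≢1 ← ∃-non-root-of-unity k k<q | ∑ elements (_^ suc k) ≟ 0#
  ... | yes S≡0 = S≡0
  ... | no S≢0 with h , gh≡1 ← invertible g g≢0 = contradiction (begin
      (g ^ suc k - 1#) * S      ≡⟨ solve 3 (λ a b s → (a :- b) :* s := a :* s :- b :* s) refl _ 1# S ⟩
      g ^ suc k * S - 1# * S    ≡⟨ cong₂ _-_ (sym invariant) (*-identityˡ S) ⟩
      S - S                     ≡⟨ -‿inverseʳ S ⟩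
      0#                        ∎)
      (*-≢0 (λ e → gᵏ≢1 (x∙y⁻¹≈ε⇒x≈y _ _ e)) S≢0)
    where
    S = ∑ elements (_^ suc k)

    cancel : ∀ {a b} → a * b ≡ 1# → ∀ x → a * (b * x) ≡ x
    cancel {a} {b} ab≡1 x = trans (sym (*-assoc a b x)) (trans (cong (_* x) ab≡1) (*-identityˡ x))

    invariant : S ≡ g ^ suc k * S
    invariant = begin
      S
        ≡⟨ ∑-bijection (g *_) (h *_) (cancel gh≡1) (cancel (trans (*-comm h g) gh≡1)) (_^ suc k) ⟨
      ∑ elements (λ x → (g * x) ^ suc k)
        ≡⟨ ∑-cong elements (λ x → ^-distrib-* g x (suc k)) ⟩
      ∑ elements (λ x → g ^ suc k * x ^ suc k)
        ≡⟨ ∑-*ˡ (g ^ suc k) (_^ suc k) elements ⟩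
      g ^ suc k * S ∎

  -- Congruence modulo p as equality in the field.

  module Characteristic {p h : ℕ} (p-prime : Prime p) (q≡pʰ : q ≡ p ℕ.^ h) where
    private instance
      p≢0 : NonZero p
      p≢0 = prime⇒nonZero p-prime

    p·1≡0 : p · 1# ≡ 0#
    p·1≡0 with p · 1# ≟ 0#
    ... | yes ≡0 = ≡0
    ... | no ≢0  = contradiction (trans (cong (_· 1#) (sym q≡pʰ)) q·1≡0) (power≢0 h)
      where
      power≢0 : ∀ n → (p ℕ.^ n) · 1# ≢ 0#
      power≢0 zero    eq = 1≢0 (trans (sym (+-identityʳ 1#)) eq)
      power≢0 (suc n) eq = *-≢0 ≢0 (power≢0 n) (trans (sym (×1-homo-* p (p ℕ.^ n))) eq)

    multiple·1≡0 : ∀ n → (n ℕ.* p) · 1# ≡ 0#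
    multiple·1≡0 n = trans (×1-homo-* n p) (trans (cong (n · 1# *_) p·1≡0) (zeroʳ _))

    ∣⇒·1≡0 : ∀ {n} → p ∣ℕ n → n · 1# ≡ 0#
    ∣⇒·1≡0 (divides n refl) = multiple·1≡0 n

    -- By Bézout, 1 is an integer combination of n and p, and both would annihilate 1 in the field.
    below·1≢0 : ∀ n .{{_ : NonZero n}} → n ℕ.< p → n · 1# ≢ 0#
    below·1≢0 n n<p n·1≡0 with coprime-Bézout (prime⇒coprime p-prime n<p)
    ... | Bézout.+- x y eq = 1≢0 (begin
      1#                        ≡⟨ +-identityʳ 1# ⟨
      1 · 1#                    ≡⟨ +-identityʳ _ ⟨
      1 · 1# + 0#               ≡⟨ cong (1 · 1# +_) yn·1≡0 ⟨
      1 · 1# + (y ℕ.* n) · 1#   ≡⟨ ×-homo-+ 1# 1 (y ℕ.* n) ⟨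
      (1 ℕ.+ y ℕ.* n) · 1#      ≡⟨ cong (_· 1#) eq ⟩
      (x ℕ.* p) · 1#            ≡⟨ multiple·1≡0 x ⟩
      0#                        ∎)
      where
      yn·1≡0 : (y ℕ.* n) · 1# ≡ 0#
      yn·1≡0 = trans (×1-homo-* y n) (trans (cong (y · 1# *_) n·1≡0) (zeroʳ _))
    ... | Bézout.-+ x y eq = 1≢0 (begin
      1#                        ≡⟨ +-identityʳ 1# ⟨
      1 · 1#                    ≡⟨ +-identityʳ _ ⟨
      1 · 1# + 0#               ≡⟨ cong (1 · 1# +_) (multiple·1≡0 x) ⟨
      1 · 1# + (x ℕ.* p) · 1#   ≡⟨ ×-homo-+ 1# 1 (x ℕ.* p) ⟨
      (1 ℕ.+ x ℕ.* p) · 1#      ≡⟨ cong (_· 1#) eq ⟩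
      (y ℕ.* n) · 1#            ≡⟨ yn·1≡0 ⟩
      0#                        ∎)
      where
      yn·1≡0 : (y ℕ.* n) · 1# ≡ 0#
      yn·1≡0 = trans (×1-homo-* y n) (trans (cong (y · 1# *_) n·1≡0) (zeroʳ _))

    ·1≡0⇒∣ : ∀ n → n · 1# ≡ 0# → p ∣ℕ n
    ·1≡0⇒∣ n n·1≡0 with n % p in r≡
    ... | zero  = m%n≡0⇒n∣m n p r≡
    ... | suc r = contradiction (begin
      suc r · 1#                                  ≡⟨ cong (_· 1#) r≡ ⟨
      (n % p) · 1#                                ≡⟨ +-identityʳ _ ⟨
      (n % p) · 1# + 0#                           ≡⟨ cong ((n % p) · 1# +_) (multiple·1≡0 (n / p)) ⟨
      (n % p) · 1# + (n / p ℕ.* p) · 1#           ≡⟨ ×-homo-+ 1# (n % p) _ ⟨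
      (n % p ℕ.+ n / p ℕ.* p) · 1#                ≡⟨ cong (_· 1#) (m≡m%n+[m/n]*n n p) ⟨
      n · 1#                                      ≡⟨ n·1≡0 ⟩
      0#                                          ∎)
      (below·1≢0 (suc r) (subst (ℕ._< p) r≡ (m%n<n n p)))

    ·1-∸ : ∀ {m n} → m ℕ.≤ n → n · 1# - m · 1# ≡ (n ℕ.∸ m) · 1#
    ·1-∸ {m} {n} m≤n = begin
      n · 1# - m · 1#                            ≡⟨ cong (λ k → k · 1# - m · 1#) (ℕ.m+[n∸m]≡n m≤n) ⟨
      (m ℕ.+ (n ℕ.∸ m)) · 1# - m · 1#            ≡⟨ cong (_- m · 1#) (×-homo-+ 1# m (n ℕ.∸ m)) ⟩
      m · 1# + (n ℕ.∸ m) · 1# - m · 1#           ≡⟨ solve 2 (λ x y → x :+ y :- x := y) refl (m · 1#) _ ⟩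
      (n ℕ.∸ m) · 1#                             ∎

    private
      swap-difference : ∀ {x y} → x - y ≡ 0# → y - x ≡ 0#
      swap-difference {x} {y} x-y≡0 =
        trans (cong (λ z → y - z) (x∙y⁻¹≈ε⇒x≈y x y x-y≡0)) (-‿inverseʳ y)

    -- With its converse below, this makes the weight of a line, its intersection number minus the
    -- typical one read in the field, vanish exactly for typical lines.
    ∣⇒difference≡0 : ∀ m n → p ∣ℕ ∣ m - n ∣ → m · 1# - n · 1# ≡ 0#
    ∣⇒difference≡0 m n p∣ with ℕ.≤-total n m
    ... | inj₁ n≤m = trans (·1-∸ n≤m) (∣⇒·1≡0 (subst (p ∣ℕ_) (ℕ.m≤n⇒∣n-m∣≡n∸m n≤m) p∣))
    ... | inj₂ m≤n = swap-difference
      (trans (·1-∸ m≤n) (∣⇒·1≡0 (subst (p ∣ℕ_) (ℕ.m≤n⇒∣m-n∣≡n∸m m≤n) p∣)))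

    difference≡0⇒∣ : ∀ m n → m · 1# - n · 1# ≡ 0# → p ∣ℕ ∣ m - n ∣
    difference≡0⇒∣ m n ≡0 with ℕ.≤-total n m
    ... | inj₁ n≤m = subst (p ∣ℕ_) (sym (ℕ.m≤n⇒∣n-m∣≡n∸m n≤m))
      (·1≡0⇒∣ _ (trans (sym (·1-∸ n≤m)) ≡0))
    ... | inj₂ m≤n = subst (p ∣ℕ_) (sym (ℕ.m≤n⇒∣m-n∣≡n∸m m≤n))
      (·1≡0⇒∣ _ (trans (sym (·1-∸ m≤n)) (swap-difference ≡0)))

-- The commutative ring of polynomials in three variables.

module PolynomialRing {q : ℕ} (F : FiniteField q) where
  open FiniteField F using (commutativeRing; _≟_; _^_)
  open CommutativeRing commutativeRing 
    hiding (refl; sym; trans; reflexive; zero; _≉_; _≈_; isCommutativeRing)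
  open IntegerSolver commutativeRing
  open FiniteFieldProperties F
  open Polynomial F
  open import Algebra.Properties.Ring ring using (-0#≈0#; x∙y⁻¹≈ε⇒x≈y)
  open import Algebra.Properties.Semiring.Exp semiring using (^-homo-*)
  open ≡-Reasoning

  infixl 6 _⊞_
  _⊞_ : Exponent → Exponent → Exponent
  _⊞_ = Vec.zipWith ℕ._+_

  -- Every linear functional on polynomials is f ↦ ⟨ f , φ ⟩ for some φ;
  -- equality of polynomials is equality under all of these.
  ⟨_,_⟩ : Poly → (Exponent → Carrier) → Carrier
  ⟨ f , φ ⟩ = ∑ f (λ t → proj₁ t * φ (proj₂ t))

  pairing-cong : ∀ f {φ ψ} → (∀ d → φ d ≡ ψ d) → ⟨ f , φ ⟩ ≡ ⟨ f , ψ ⟩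
  pairing-cong f φ≡ψ = ∑-cong f (λ (c , d) → cong (c *_) (φ≡ψ d))

  pairing-+ : ∀ f g φ → ⟨ f +ₚ g , φ ⟩ ≡ ⟨ f , φ ⟩ + ⟨ g , φ ⟩
  pairing-+ []            g φ = sym (+-identityˡ _)
  pairing-+ ((c , d) ∷ f) g φ = trans (cong (c * φ d +_) (pairing-+ f g φ)) (sym (+-assoc _ _ _))

  pairing-linear : ∀ f x y φ ψ → ⟨ f , (λ d → x * φ d + y * ψ d) ⟩ ≡ x * ⟨ f , φ ⟩ + y * ⟨ f , ψ ⟩
  pairing-linear [] x y φ ψ = sym (trans (cong₂ _+_ (zeroʳ x) (zeroʳ y)) (+-identityʳ 0#))
  pairing-linear ((c , d) ∷ f) x y φ ψ = trans
    (cong (c * (x * φ d + y * ψ d) +_) (pairing-linear f x y φ ψ))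
    (solve 7 (λ c x y u v s t → c :* (x :* u :+ y :* v) :+ (x :* s :+ y :* t) :=
                                x :* (c :* u :+ s) :+ y :* (c :* v :+ t))
      refl c x y (φ d) (ψ d) _ _)

  infix 21 -ₚ_
  -ₚ_ : Poly → Poly
  -ₚ f = map (λ (c , d) → - c , d) f

  pairing-neg : ∀ f φ → ⟨ -ₚ f , φ ⟩ ≡ - ⟨ f , φ ⟩
  pairing-neg []            φ = sym -0#≈0#
  pairing-neg ((c , d) ∷ f) φ = trans (cong (- c * φ d +_) (pairing-neg f φ))
    (solve 3 (λ c u s → :- c :* u :+ :- s := :- (c :* u :+ s)) refl c (φ d) _)

  pairing-monomial-* : ∀ c d g φ → ⟨ map (λ (c′ , d′) → c * c′ , d ⊞ d′) g , φ ⟩ ≡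
    c * ⟨ g , (λ d′ → φ (d ⊞ d′)) ⟩
  pairing-monomial-* c d []              φ = sym (zeroʳ c)
  pairing-monomial-* c d ((c′ , d′) ∷ g) φ = trans
    (cong (c * c′ * φ (d ⊞ d′) +_) (pairing-monomial-* c d g φ))
    (solve 4 (λ c c′ u s → c :* c′ :* u :+ c :* s := c :* (c′ :* u :+ s)) refl c c′ (φ (d ⊞ d′)) _)

  pairing-* : ∀ f g φ → ⟨ f *ₚ g , φ ⟩ ≡ ⟨ f , (λ d → ⟨ g , (λ d′ → φ (d ⊞ d′)) ⟩) ⟩
  pairing-* []            g φ = refl
  pairing-* ((c , d) ∷ f) g φ = trans (pairing-+ (map _ g) (f *ₚ g) φ)
    (cong₂ _+_ (pairing-monomial-* c d g φ) (pairing-* f g φ))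

  coeff-pairing : ∀ f e → coeff f e ≡ ⟨ f , (λ d → indicator (d ≟ᵉ e)) ⟩
  coeff-pairing []            e = refl
  coeff-pairing ((c , d) ∷ f) e with d ≟ᵉ e
  ... | yes _ = cong₂ _+_ (sym (*-identityʳ c)) (coeff-pairing f e)
  ... | no _  = trans (coeff-pairing f e) (sym (trans (cong₂ _+_ (zeroʳ c) refl) (+-identityˡ _)))

  pairing-0 : ∀ f φ → All (λ t → φ (proj₂ t) ≡ 0#) f → ⟨ f , φ ⟩ ≡ 0#
  pairing-0 []            φ []          = refl
  pairing-0 ((c , d) ∷ f) φ (φd≡0 ∷ ps) =
    trans (cong₂ _+_ (trans (cong (c *_) φd≡0) (zeroʳ c)) (pairing-0 f φ ps)) (+-identityʳ 0#)

  -- Exponents are stripped off one at a time: φ is φ(e) times the indicator of e, which computes a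
  -- coefficient, plus a function that vanishes at e. The list `es` covers the terms of `f` where φ
  -- has not yet been made zero.
  coeff-zero⇒pairing-zero : ∀ f → (∀ e → coeff f e ≡ 0#) → ∀ es φ →
    All (λ t → proj₂ t ∈ es ⊎ φ (proj₂ t) ≡ 0#) f → ⟨ f , φ ⟩ ≡ 0#
  coeff-zero⇒pairing-zero f f≡0 []       φ supp = pairing-0 f φ (All.map (λ { (inj₂ ≡0) → ≡0 }) supp)
  coeff-zero⇒pairing-zero f f≡0 (e ∷ es) φ supp = begin
    ⟨ f , φ ⟩
      ≡⟨ pairing-cong f split ⟩
    ⟨ f , (λ d → φ e * indicator (d ≟ᵉ e) + 1# * rest d) ⟩
      ≡⟨ pairing-linear f (φ e) 1# _ rest ⟩
    φ e * ⟨ f , (λ d → indicator (d ≟ᵉ e)) ⟩ + 1# * ⟨ f , rest ⟩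
      ≡⟨ cong₂ (λ x y → φ e * x + 1# * y) (trans (sym (coeff-pairing f e)) (f≡0 e))
           (coeff-zero⇒pairing-zero f f≡0 es rest (All.map (λ {t} → restSupport (proj₂ t)) supp)) ⟩
    φ e * 0# + 1# * 0#
      ≡⟨ trans (cong₂ _+_ (zeroʳ _) (zeroʳ _)) (+-identityʳ 0#) ⟩
    0# ∎
    where
    rest : Exponent → Carrier
    rest d with d ≟ᵉ e
    ... | yes _ = 0#
    ... | no _  = φ d

    split : ∀ d → φ d ≡ φ e * indicator (d ≟ᵉ e) + 1# * rest d
    split d with d ≟ᵉ e
    ... | yes refl = sym (trans (cong₂ _+_ (*-identityʳ _) (zeroʳ _)) (+-identityʳ _))
    ... | no _     = sym (trans (cong₂ _+_ (zeroʳ _) (*-identityˡ _)) (+-identityˡ _))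

    restSupport : ∀ d → d ∈ e ∷ es ⊎ φ d ≡ 0# → d ∈ es ⊎ rest d ≡ 0#
    restSupport d s with d ≟ᵉ e | s
    ... | yes _  | _                = inj₂ refl
    ... | no d≢e | inj₁ (here d≡e)  = contradiction d≡e d≢e
    ... | no _   | inj₁ (there d∈)  = inj₁ d∈
    ... | no _   | inj₂ φd≡0        = inj₂ φd≡0

  pairing⇒≈ₚ : ∀ f g → (∀ φ → ⟨ f , φ ⟩ ≡ ⟨ g , φ ⟩) → f ≈ₚ g
  pairing⇒≈ₚ f g f≡g e = trans (coeff-pairing f e) (trans (f≡g _) (sym (coeff-pairing g e)))

  ≈ₚ⇒pairing : ∀ f g → f ≈ₚ g → ∀ φ → ⟨ f , φ ⟩ ≡ ⟨ g , φ ⟩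
  ≈ₚ⇒pairing f g f≈g φ = x∙y⁻¹≈ε⇒x≈y _ _ (begin
    ⟨ f , φ ⟩ - ⟨ g , φ ⟩   ≡⟨ pairing-difference φ ⟨
    ⟨ f +ₚ -ₚ g , φ ⟩       ≡⟨ coeff-zero⇒pairing-zero (f +ₚ -ₚ g) coeff≡0 (map proj₂ (f +ₚ -ₚ g)) φ
                                (All.tabulate (λ t∈ → inj₁ (∈-map⁺ proj₂ t∈))) ⟩
    0#                      ∎)
    where
    pairing-difference : ∀ ψ → ⟨ f +ₚ -ₚ g , ψ ⟩ ≡ ⟨ f , ψ ⟩ - ⟨ g , ψ ⟩
    pairing-difference ψ = trans (pairing-+ f (-ₚ g) ψ) (cong (⟨ f , ψ ⟩ +_) (pairing-neg g ψ))

    coeff≡0 : ∀ e → coeff (f +ₚ -ₚ g) e ≡ 0#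
    coeff≡0 e = begin
      coeff (f +ₚ -ₚ g) e       ≡⟨ coeff-pairing (f +ₚ -ₚ g) e ⟩
      ⟨ f +ₚ -ₚ g , _ ⟩         ≡⟨ pairing-difference _ ⟩
      ⟨ f , _ ⟩ - ⟨ g , _ ⟩     ≡⟨ cong₂ _-_ (coeff-pairing f e) (coeff-pairing g e) ⟨
      coeff f e - coeff g e     ≡⟨ cong (_- coeff g e) (f≈g e) ⟩
      coeff g e - coeff g e     ≡⟨ -‿inverseʳ _ ⟩
      0#                        ∎

  +ₚ-cong : ∀ {f f′ g g′} → f ≈ₚ f′ → g ≈ₚ g′ → (f +ₚ g) ≈ₚ (f′ +ₚ g′)
  +ₚ-cong {f} {f′} {g} {g′} f≈f′ g≈g′ = pairing⇒≈ₚ (f +ₚ g) (f′ +ₚ g′) (λ φ → begin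
    ⟨ f +ₚ g , φ ⟩            ≡⟨ pairing-+ f g φ ⟩
    ⟨ f , φ ⟩ + ⟨ g , φ ⟩     ≡⟨ cong₂ _+_ (≈ₚ⇒pairing f f′ f≈f′ φ) (≈ₚ⇒pairing g g′ g≈g′ φ) ⟩
    ⟨ f′ , φ ⟩ + ⟨ g′ , φ ⟩   ≡⟨ pairing-+ f′ g′ φ ⟨
    ⟨ f′ +ₚ g′ , φ ⟩          ∎)

  +ₚ-comm : ∀ f g → (f +ₚ g) ≈ₚ (g +ₚ f)
  +ₚ-comm f g = pairing⇒≈ₚ (f +ₚ g) (g +ₚ f) (λ φ →
    trans (pairing-+ f g φ) (trans (+-comm _ _) (sym (pairing-+ g f φ))))

  -ₚ-cong : ∀ {f g} → f ≈ₚ g → (-ₚ f) ≈ₚ (-ₚ g)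
  -ₚ-cong {f} {g} f≈g = pairing⇒≈ₚ (-ₚ f) (-ₚ g) (λ φ →
    trans (pairing-neg f φ) (trans (cong -_ (≈ₚ⇒pairing f g f≈g φ)) (sym (pairing-neg g φ))))

  -ₚ-inverseˡ : ∀ f → ((-ₚ f) +ₚ f) ≈ₚ 0ₚ
  -ₚ-inverseˡ f = pairing⇒≈ₚ ((-ₚ f) +ₚ f) (0ₚ) (λ φ →
    trans (pairing-+ (-ₚ f) f φ) (trans (cong (_+ ⟨ f , φ ⟩) (pairing-neg f φ)) (-‿inverseˡ _)))

  *ₚ-cong : ∀ {f f′ g g′} → f ≈ₚ f′ → g ≈ₚ g′ → (f *ₚ g) ≈ₚ (f′ *ₚ g′)
  *ₚ-cong {f} {f′} {g} {g′} f≈f′ g≈g′ = pairing⇒≈ₚ (f *ₚ g) (f′ *ₚ g′) (λ φ → begin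
    ⟨ f *ₚ g , φ ⟩                                 ≡⟨ pairing-* f g φ ⟩
    ⟨ f , (λ d → ⟨ g , (λ d′ → φ (d ⊞ d′)) ⟩) ⟩    ≡⟨ ≈ₚ⇒pairing f f′ f≈f′ _ ⟩
    ⟨ f′ , (λ d → ⟨ g , (λ d′ → φ (d ⊞ d′)) ⟩) ⟩   ≡⟨ pairing-cong f′ (λ d → ≈ₚ⇒pairing g g′ g≈g′ _) ⟩
    ⟨ f′ , (λ d → ⟨ g′ , (λ d′ → φ (d ⊞ d′)) ⟩) ⟩  ≡⟨ pairing-* f′ g′ φ ⟨
    ⟨ f′ *ₚ g′ , φ ⟩                               ∎)

  *ₚ-assoc : ∀ f g h → ((f *ₚ g) *ₚ h) ≈ₚ (f *ₚ (g *ₚ h))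
  *ₚ-assoc f g h = pairing⇒≈ₚ ((f *ₚ g) *ₚ h) (f *ₚ (g *ₚ h)) (λ φ → begin
    ⟨ (f *ₚ g) *ₚ h , φ ⟩
      ≡⟨ pairing-* (f *ₚ g) h φ ⟩
    ⟨ f *ₚ g , (λ d → ⟨ h , (λ d″ → φ (d ⊞ d″)) ⟩) ⟩
      ≡⟨ pairing-* f g _ ⟩
    ⟨ f , (λ d → ⟨ g , (λ d′ → ⟨ h , (λ d″ → φ (d ⊞ d′ ⊞ d″)) ⟩) ⟩) ⟩
      ≡⟨ pairing-cong f (λ d → pairing-cong g (λ d′ → pairing-cong h (λ d″ →
           cong φ (Vec.zipWith-assoc ℕ.+-assoc d d′ d″)))) ⟩
    ⟨ f , (λ d → ⟨ g , (λ d′ → ⟨ h , (λ d″ → φ (d ⊞ (d′ ⊞ d″))) ⟩) ⟩) ⟩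
      ≡⟨ pairing-cong f (λ d → pairing-* g h _) ⟨
    ⟨ f , (λ d → ⟨ g *ₚ h , (λ d′ → φ (d ⊞ d′)) ⟩) ⟩
      ≡⟨ pairing-* f (g *ₚ h) φ ⟨
    ⟨ f *ₚ (g *ₚ h) , φ ⟩ ∎)

  *ₚ-comm : ∀ f g → (f *ₚ g) ≈ₚ (g *ₚ f)
  *ₚ-comm f g = pairing⇒≈ₚ (f *ₚ g) (g *ₚ f) (λ φ → begin
    ⟨ f *ₚ g , φ ⟩
      ≡⟨ pairing-* f g φ ⟩
    ∑ f (λ t → proj₁ t * ∑ g (λ u → proj₁ u * φ (proj₂ t ⊞ proj₂ u)))
      ≡⟨ ∑-cong f (λ t → ∑-*ˡ (proj₁ t) _ g) ⟨
    ∑ f (λ t → ∑ g (λ u → proj₁ t * (proj₁ u * φ (proj₂ t ⊞ proj₂ u))))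
      ≡⟨ ∑-swap _ f g ⟩
    ∑ g (λ u → ∑ f (λ t → proj₁ t * (proj₁ u * φ (proj₂ t ⊞ proj₂ u))))
      ≡⟨ ∑-cong g (λ u → ∑-cong f (λ t → trans
           (solve 3 (λ x y z → x :* (y :* z) := y :* (x :* z)) refl (proj₁ t) (proj₁ u) _)
           (cong (λ d → proj₁ u * (proj₁ t * φ d)) (Vec.zipWith-comm ℕ.+-comm (proj₂ t) (proj₂ u))))) ⟩
    ∑ g (λ u → ∑ f (λ t → proj₁ u * (proj₁ t * φ (proj₂ u ⊞ proj₂ t))))
      ≡⟨ ∑-cong g (λ u → ∑-*ˡ (proj₁ u) _ f) ⟩
    ∑ g (λ u → proj₁ u * ∑ f (λ t → proj₁ t * φ (proj₂ u ⊞ proj₂ t)))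
      ≡⟨ pairing-* g f φ ⟨
    ⟨ g *ₚ f , φ ⟩ ∎)

  *ₚ-identityˡ : ∀ f → (1ₚ *ₚ f) ≈ₚ f
  *ₚ-identityˡ f = pairing⇒≈ₚ (1ₚ *ₚ f) f (λ φ → begin
    ⟨ 1ₚ *ₚ f , φ ⟩
      ≡⟨ pairing-* 1ₚ f φ ⟩
    1# * ⟨ f , (λ d → φ (Vec.replicate 3 0 ⊞ d)) ⟩ + 0#
      ≡⟨ trans (+-identityʳ _) (*-identityˡ _) ⟩
    ⟨ f , (λ d → φ (Vec.replicate 3 0 ⊞ d)) ⟩
      ≡⟨ pairing-cong f (λ d → cong φ (Vec.zipWith-identityˡ ℕ.+-identityˡ d)) ⟩
    ⟨ f , φ ⟩ ∎)

  *ₚ-distribʳ-+ₚ : ∀ f g h → ((g +ₚ h) *ₚ f) ≈ₚ ((g *ₚ f) +ₚ (h *ₚ f))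
  *ₚ-distribʳ-+ₚ f g h = pairing⇒≈ₚ ((g +ₚ h) *ₚ f) ((g *ₚ f) +ₚ (h *ₚ f)) (λ φ → begin
    ⟨ (g +ₚ h) *ₚ f , φ ⟩
      ≡⟨ pairing-* (g +ₚ h) f φ ⟩
    ⟨ g +ₚ h , (λ d → ⟨ f , (λ d′ → φ (d ⊞ d′)) ⟩) ⟩
      ≡⟨ pairing-+ g h _ ⟩
    ⟨ g , (λ d → ⟨ f , (λ d′ → φ (d ⊞ d′)) ⟩) ⟩ + ⟨ h , (λ d → ⟨ f , (λ d′ → φ (d ⊞ d′)) ⟩) ⟩
      ≡⟨ cong₂ _+_ (pairing-* g f φ) (pairing-* h f φ) ⟨
    ⟨ g *ₚ f , φ ⟩ + ⟨ h *ₚ f , φ ⟩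
      ≡⟨ pairing-+ (g *ₚ f) (h *ₚ f) φ ⟨
    ⟨ (g *ₚ f) +ₚ (h *ₚ f) , φ ⟩ ∎)

  *ₚ-distribˡ-+ₚ : ∀ f g h → (f *ₚ (g +ₚ h)) ≈ₚ ((f *ₚ g) +ₚ (f *ₚ h))
  *ₚ-distribˡ-+ₚ f g h e = trans (*ₚ-comm f (g +ₚ h) e) (trans (*ₚ-distribʳ-+ₚ f g h e)
    (+ₚ-cong {g *ₚ f} {f *ₚ g} {h *ₚ f} {f *ₚ h} (*ₚ-comm g f) (*ₚ-comm h f) e))

  polyRing : CommutativeRing 0ℓ 0ℓ
  polyRing = record
    { Carrier = Poly ; _≈_ = _≈ₚ_ ; _+_ = _+ₚ_ ; _*_ = _*ₚ_ ; -_ = -ₚ_ ; 0# = 0ₚ ; 1# = 1ₚ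
    ; isCommutativeRing = record
      { isRing = record
        { +-isAbelianGroup = record
          { isGroup = record
            { isMonoid = record
              { isSemigroup = record
                { isMagma = record
                  { isEquivalence = record
                    { refl  = λ _ → refl
                    ; sym   = λ f≈g e → sym (f≈g e)
                    ; trans = λ f≈g g≈h e → trans (f≈g e) (g≈h e)
                    }
                  ; ∙-cong = λ {f} {f′} {g} {g′} → +ₚ-cong {f} {f′} {g} {g′}
                  }
                ; assoc = λ f g h e → cong (λ k → coeff k e) (++-assoc f g h)
                }
              ; identity = (λ f e → refl) , (λ f e → cong (λ k → coeff k e) (++-identityʳ f))
              }
            ; inverse = -ₚ-inverseˡ , λ f e → trans (+ₚ-comm f (-ₚ f) e) (-ₚ-inverseˡ f e)
            ; ⁻¹-cong = λ {f} {g} → -ₚ-cong {f} {g}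
            }
          ; comm = +ₚ-comm
          }
        ; *-cong     = λ {f} {f′} {g} {g′} → *ₚ-cong {f} {f′} {g} {g′}
        ; *-assoc    = *ₚ-assoc
        ; *-identity = *ₚ-identityˡ , λ f e → trans (*ₚ-comm f 1ₚ e) (*ₚ-identityˡ f e)
        ; distrib    = *ₚ-distribˡ-+ₚ , *ₚ-distribʳ-+ₚ
        }
      ; *-comm = *ₚ-comm
      }
    }

  private
    module P = CommutativeRing polyRing

  constant : Carrier → Poly
  constant c = (c , Vec.replicate 3 0) ∷ []

  constant-isRingHomomorphism :
    RingMorphisms.IsRingHomomorphism (CommutativeRing.rawRing commutativeRing) P.rawRing constant
  constant-isRingHomomorphism = record
    { isSemiringHomomorphism = record
      { isNearSemiringHomomorphism = record
        { +-isMonoidHomomorphism = record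
          { isMagmaHomomorphism = record
            { isRelHomomorphism = record { cong = λ { refl e → refl } }
            ; homo = λ x y → pairing⇒≈ₚ (constant (x + y)) (constant x +ₚ constant y) (λ φ →
                solve 4 (λ x y u z → (x :+ y) :* u :+ z := x :* u :+ (y :* u :+ z))
                  refl x y (φ (Vec.replicate 3 0)) 0#)
            }
          ; ε-homo = pairing⇒≈ₚ (constant 0#) (0ₚ) (λ φ → trans (+-identityʳ _) (zeroˡ _))
          }
        ; *-homo = λ x y e → refl
        }
      ; 1#-homo = λ e → refl
      }
    ; -‿homo = λ x e → refl
    }

  eval-pairing : ∀ f v → eval f v ≡ ⟨ f , (λ d → evalMonomial d v) ⟩
  eval-pairing []            v = refl
  eval-pairing ((c , d) ∷ f) v = cong (c * evalMonomial d v +_) (eval-pairing f v)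

  evalMonomial-⊞ : ∀ d e v → evalMonomial (d ⊞ e) v ≡ evalMonomial d v * evalMonomial e v
  evalMonomial-⊞ (i ∷ j ∷ k ∷ []) (i′ ∷ j′ ∷ k′ ∷ []) (x ∷ y ∷ z ∷ []) = begin
    x ^ (i ℕ.+ i′) * (y ^ (j ℕ.+ j′) * (z ^ (k ℕ.+ k′) * 1#))
      ≡⟨ cong₂ _*_ (^-homo-* x i i′) (cong₂ _*_ (^-homo-* y j j′) (cong (_* 1#) (^-homo-* z k k′))) ⟩
    x ^ i * x ^ i′ * (y ^ j * y ^ j′ * (z ^ k * z ^ k′ * 1#))
      ≡⟨ cong (λ u → x ^ i * x ^ i′ * (y ^ j * y ^ j′ * (z ^ k * z ^ k′ * u))) (*-identityˡ 1#) ⟨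
    x ^ i * x ^ i′ * (y ^ j * y ^ j′ * (z ^ k * z ^ k′ * (1# * 1#)))
      ≡⟨ solve 7 (λ a a′ b b′ c c′ u → a :* a′ :* (b :* b′ :* (c :* c′ :* (u :* u))) :=
                                       a :* (b :* (c :* u)) :* (a′ :* (b′ :* (c′ :* u))))
           refl (x ^ i) (x ^ i′) (y ^ j) (y ^ j′) (z ^ k) (z ^ k′) 1# ⟩
    x ^ i * (y ^ j * (z ^ k * 1#)) * (x ^ i′ * (y ^ j′ * (z ^ k′ * 1#))) ∎

  eval-cong : ∀ {f g} v → f ≈ₚ g → eval f v ≡ eval g v
  eval-cong {f} {g} v f≈g = trans (eval-pairing f v) (trans (≈ₚ⇒pairing f g f≈g _) (sym (eval-pairing g v)))

  eval-+ : ∀ v f g → eval (f +ₚ g) v ≡ eval f v + eval g v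
  eval-+ v f g = trans (eval-pairing (f +ₚ g) v) (trans (pairing-+ f g _)
    (sym (cong₂ _+_ (eval-pairing f v) (eval-pairing g v))))

  eval-neg : ∀ v f → eval (-ₚ f) v ≡ - eval f v
  eval-neg v f = trans (eval-pairing (-ₚ f) v) (trans (pairing-neg f _) (cong -_ (sym (eval-pairing f v))))

  eval-* : ∀ v f g → eval (f *ₚ g) v ≡ eval f v * eval g v
  eval-* v f g = begin
    eval (f *ₚ g) v
      ≡⟨ eval-pairing (f *ₚ g) v ⟩
    ⟨ f *ₚ g , (λ d → evalMonomial d v) ⟩
      ≡⟨ pairing-* f g _ ⟩
    ⟨ f , (λ d → ⟨ g , (λ d′ → evalMonomial (d ⊞ d′) v) ⟩) ⟩
      ≡⟨ ∑-cong f (λ (c , d) → cong (c *_) (trans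
           (∑-cong g (λ (c′ , d′) → trans (cong (c′ *_) (evalMonomial-⊞ d d′ v))
             (solve 3 (λ x y z → x :* (y :* z) := y :* (x :* z))
               refl c′ (evalMonomial d v) (evalMonomial d′ v))))
           (∑-*ˡ (evalMonomial d v) _ g))) ⟩
    ∑ f (λ (c , d) → c * (evalMonomial d v * ⟨ g , (λ d′ → evalMonomial d′ v) ⟩))
      ≡⟨ ∑-cong f (λ (c , d) →
           solve 3 (λ x y z → x :* (y :* z) := z :* (x :* y)) refl c (evalMonomial d v) _) ⟩
    ∑ f (λ (c , d) → ⟨ g , (λ d′ → evalMonomial d′ v) ⟩ * (c * evalMonomial d v))
      ≡⟨ ∑-*ˡ _ _ f ⟩
    ⟨ g , (λ d′ → evalMonomial d′ v) ⟩ * ⟨ f , (λ d → evalMonomial d v) ⟩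
      ≡⟨ *-comm _ _ ⟩
    ⟨ f , (λ d → evalMonomial d v) ⟩ * ⟨ g , (λ d′ → evalMonomial d′ v) ⟩
      ≡⟨ cong₂ _*_ (eval-pairing f v) (eval-pairing g v) ⟨
    eval f v * eval g v ∎

  eval-1 : ∀ v → eval 1ₚ v ≡ 1#
  eval-1 (x ∷ y ∷ z ∷ []) = trans (+-identityʳ _) (trans (*-identityˡ _)
    (trans (*-identityˡ _) (trans (*-identityˡ _) (*-identityˡ _))))

  eval-isRingHomomorphism : ∀ v →
    RingMorphisms.IsRingHomomorphism P.rawRing (CommutativeRing.rawRing commutativeRing) (λ f → eval f v)
  eval-isRingHomomorphism v = record
    { isSemiringHomomorphism = record
      { isNearSemiringHomomorphism = record
        { +-isMonoidHomomorphism = record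
          { isMagmaHomomorphism = record
            { isRelHomomorphism = record { cong = λ {f} {g} → eval-cong {f} {g} v }
            ; homo = eval-+ v
            }
          ; ε-homo = refl
          }
        ; *-homo = eval-* v
        }
      ; 1#-homo = eval-1 v
      }
    ; -‿homo = eval-neg v
    }

  -- Stronger than `Homogeneous`: every stored term must have degree n, even one that cancels. In
  -- this form the property passes to sums and products without inspecting coefficients.
  Terms : ℕ → Poly → Set
  Terms n f = All (λ t → Vec.sum (proj₂ t) ≡ n) f

  Terms-homogeneous : ∀ {n} f → Terms n f → Homogeneous n f
  Terms-homogeneous []            []       e ≢0 = contradiction refl ≢0
  Terms-homogeneous ((c , d) ∷ f) (d≡ ∷ f≡) e ≢0 with d ≟ᵉ e
  ... | yes refl = d≡
  ... | no _     = Terms-homogeneous f f≡ e ≢0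

  Terms-+ : ∀ {n f g} → Terms n f → Terms n g → Terms n (f +ₚ g)
  Terms-+ = All.++⁺

  Terms-neg : ∀ {n f} → Terms n f → Terms n (-ₚ f)
  Terms-neg ps = All.map⁺ ps

  sum-⊞ : ∀ d e → Vec.sum (d ⊞ e) ≡ Vec.sum d ℕ.+ Vec.sum e
  sum-⊞ (i ∷ j ∷ k ∷ []) (i′ ∷ j′ ∷ k′ ∷ []) = ℕS.solve 6 (λ i i′ j j′ k k′ →
    i ⊕ i′ ⊕ (j ⊕ j′ ⊕ (k ⊕ k′ ⊕ ℕS.con 0)) ℕS.:=
    i ⊕ (j ⊕ (k ⊕ ℕS.con 0)) ⊕ (i′ ⊕ (j′ ⊕ (k′ ⊕ ℕS.con 0)))) refl i i′ j j′ k k′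
    where
    module ℕS = ℕ.+-*-Solver
    open ℕS using () renaming (_:+_ to infixl 6 _⊕_)

  Terms-* : ∀ {m n f g} → Terms m f → Terms n g → Terms (m ℕ.+ n) (f *ₚ g)
  Terms-* []        gs = []
  Terms-* {f = (c , d) ∷ f} (d≡ ∷ fs) gs = All.++⁺
    (All.map⁺ (All.map (λ {t} e≡ → trans (sum-⊞ d (proj₂ t)) (cong₂ ℕ._+_ d≡ e≡)) gs))
    (Terms-* fs gs)

-- The degree of the Hankel determinant.

module HomogeneousHankel {q : ℕ} (F : FiniteField q) where
  open Polynomial F
  open PolynomialRing F
  open Contraction polyRing
  open ≡-Reasoning
  open ℕ.+-*-Solver

  -- Degrees grow with the column index, so every product in the expansion has the same degree,
  -- whichever column the row takes.
  Terms-contract : ∀ {m n r G} → (∀ c → Terms (m ℕ.+ c) (r c)) →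
    (∀ cs → Terms (n ℕ.+ sum cs) (G cs)) → ∀ cs → Terms (m ℕ.+ n ℕ.+ sum cs) (contract r G cs)
  Terms-contract r-terms G-terms [] = []
  Terms-contract {m} {n} {r} {G} r-terms G-terms (c ∷ cs) = Terms-+
    (subst (λ k → Terms k (r c *ₚ G cs))
      (solve 4 (λ m n c s → m :+ c :+ (n :+ s) := m :+ n :+ (c :+ s)) refl m n c (sum cs))
      (Terms-* (r-terms c) (G-terms cs)))
    (Terms-neg (subst (λ k → Terms k (contract r (G ∘ (c ∷_)) cs))
      (solve 4 (λ m n c s → m :+ (n :+ c) :+ s := m :+ n :+ (c :+ s)) refl m n c (sum cs))
      (Terms-contract r-terms (λ ds → subst (λ k → Terms k (G (c ∷ ds)))
        (sym (ℕ.+-assoc n c (sum ds))) (G-terms (c ∷ ds))) cs)))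

  rowDegrees : ℕ → ℕ → ℕ
  rowDegrees m zero    = 0
  rowDegrees m (suc n) = m ℕ.+ rowDegrees (suc m) n

  Terms-hankel : ∀ {m r} n → (∀ j → Terms (m ℕ.+ j) (r j)) →
    ∀ cs → Terms (rowDegrees m n ℕ.+ sum cs) (hankel r n unit cs)
  Terms-hankel zero r-terms []      = refl ∷ []
  Terms-hankel zero r-terms (_ ∷ _) = []
  Terms-hankel {m} {r} (suc n) r-terms cs = Terms-contract r-terms
    (Terms-hankel n (λ j → subst (λ k → Terms k (r (suc j))) (ℕ.+-suc m j) (r-terms (suc j)))) cs

  sum-map-suc : ∀ ns → sum (map suc ns) ≡ length ns ℕ.+ sum ns
  sum-map-suc []       = refl
  sum-map-suc (n ∷ ns) = trans (cong (suc n ℕ.+_) (sum-map-suc ns))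
    (solve 3 (λ n l s → con 1 :+ n :+ (l :+ s) := con 1 :+ l :+ (n :+ s)) refl n (length ns) (sum ns))

  -- The offset m is general because removing the first row raises the degrees of the new first row
  -- by one; at m = 0 the total is n².
  hankel-degree : ∀ m n → rowDegrees (suc m) n ℕ.+ sum (upTo n) ≡ n ℕ.* (m ℕ.+ n)
  hankel-degree m zero    = refl
  hankel-degree m (suc n) = begin
    suc m ℕ.+ rowDegrees (2 ℕ.+ m) n ℕ.+ sum (applyUpTo suc n)
      ≡⟨ cong (λ ns → suc m ℕ.+ rowDegrees (2 ℕ.+ m) n ℕ.+ sum ns) (map-upTo suc n) ⟨
    suc m ℕ.+ rowDegrees (2 ℕ.+ m) n ℕ.+ sum (map suc (upTo n))
      ≡⟨ cong (suc m ℕ.+ rowDegrees (2 ℕ.+ m) n ℕ.+_) 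
           (trans (sum-map-suc (upTo n)) (cong (ℕ._+ sum (upTo n)) (length-upTo n))) ⟩
    suc m ℕ.+ rowDegrees (2 ℕ.+ m) n ℕ.+ (n ℕ.+ sum (upTo n))
      ≡⟨ solve 4 (λ m r n s → con 1 :+ m :+ r :+ (n :+ s) := con 1 :+ m :+ n :+ (r :+ s))
           refl m (rowDegrees (2 ℕ.+ m) n) n (sum (upTo n)) ⟩
    suc m ℕ.+ n ℕ.+ (rowDegrees (2 ℕ.+ m) n ℕ.+ sum (upTo n))
      ≡⟨ cong (suc m ℕ.+ n ℕ.+_) (hankel-degree (suc m) n) ⟩
    suc m ℕ.+ n ℕ.+ n ℕ.* (suc m ℕ.+ n)
      ≡⟨ solve 2 (λ m n → con 1 :+ m :+ n :+ n :* (con 1 :+ m :+ n) := (con 1 :+ n) :* (m :+ (con 1 :+ n)))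
           refl m n ⟩
    suc n ℕ.* (m ℕ.+ suc n) ∎

  Terms-^ : ∀ {f} n → Terms 1 f → Terms n (f ^ₚ n)
  Terms-^ zero    f-terms = refl ∷ []
  Terms-^ (suc n) f-terms = Terms-* f-terms (Terms-^ n f-terms)

  Terms-expSum : ∀ {P : Set} (α x : P → Poly) → (∀ t → Terms 1 (α t)) → (∀ t → Terms 1 (x t)) →
    ∀ T j → Terms (suc j) (expSum (map (λ t → α t , x t) T) j)
  Terms-expSum α x α-terms x-terms []      j = []
  Terms-expSum α x α-terms x-terms (t ∷ T) j =
    Terms-+ (Terms-* (α-terms t) (Terms-^ j (x-terms t))) (Terms-expSum α x α-terms x-terms T j)

-- Lines through one direction, and the determinant on them.

module RenitentEnvelope {p h q : ℕ} (p-prime : Prime p) (q≡pʰ : q ≡ p ℕ.^ h) (F : FiniteField q)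
  (𝓣 : Plane.Multiset F) (l : ℕ) (0<l : 0 ℕ.< l) (2l<q : 2 ℕ.* l ℕ.< q) where

  open FiniteField F using (commutativeRing; elements; _≟_; 1≢0; _^_)
  open CommutativeRing commutativeRing
    hiding (refl; sym; trans; reflexive; zero; _≉_; _≈_; rawRing; isCommutativeRing)
  open IntegerSolver commutativeRing
  open FiniteFieldProperties F
  open Characteristic {h = h} p-prime q≡pʰ
  open import Algebra.Properties.Ring ring using (x∙y⁻¹≈ε⇒x≈y)
  open import Algebra.Properties.Semiring.Mult semiring using () renaming (_×_ to _·_)
  open import Algebra.Properties.Semiring.Divisibility semiring using (0∣x⇒x≈0; _∣0)
  open import Algebra.Properties.CommutativeSemigroup.Divisibility *-commutativeSemigroup
    using (_∣_; ∣-respʳ-≈; ∣-respˡ-≈)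
  open Polynomial F hiding (rawSemiring)
  open PolynomialRing F
  open HomogeneousHankel F
  open Plane F
  open Uniformity p 𝓣
  open Nonvanishing commutativeRing 1≢0 *-≢0
  open Contraction commutativeRing
  open ≡-Reasoning
  private
    module P = CommutativeRing polyRing
    module PC = Contraction polyRing
    module Id = Homomorphism commutativeRing commutativeRing
      (Identity.isRingHomomorphism (CommutativeRing.rawRing commutativeRing) refl)
    module Constant = Homomorphism commutativeRing polyRing constant-isRingHomomorphism

  expSum-∑ : ∀ {B : Set} (α x : B → Carrier) xs j →
    expSum (map (λ t → α t , x t) xs) j ≡ ∑ xs (λ t → α t * x t ^ j)
  expSum-∑ α x []       j = refl
  expSum-∑ α x (t ∷ xs) j = cong (α t * x t ^ j +_) (expSum-∑ α x xs j)

  ∑-filter : ∀ {B : Set} {Q : B → Set} (Q? : ∀ x → Dec (Q x)) (f : B → Carrier) →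
    (∀ x → ¬ Q x → f x ≡ 0#) → ∀ xs → ∑ (filter Q? xs) f ≡ ∑ xs f
  ∑-filter Q? f f≡0 [] = refl
  ∑-filter Q? f f≡0 (x ∷ xs) with Q? x
  ... | yes _ = cong (f x +_) (∑-filter Q? f f≡0 xs)
  ... | no ¬q = trans (∑-filter Q? f f≡0 xs) (sym (trans (cong (_+ ∑ xs f) (f≡0 x ¬q)) (+-identityˡ _)))

  length-filter-¬ : ∀ {B : Set} {Q : B → Set} (Q? : ∀ x → Dec (Q x)) xs →
    length (filter Q? xs) ℕ.+ length (filter (λ x → ¬? (Q? x)) xs) ≡ length xs
  length-filter-¬ Q? [] = refl
  length-filter-¬ Q? (x ∷ xs) with Q? x
  ... | yes _ = cong suc (length-filter-¬ Q? xs)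
  ... | no _  = trans (ℕ.+-suc _ _) (cong suc (length-filter-¬ Q? xs))

  length-filter-∷ : ∀ {B : Set} {Q : B → Set} (Q? : ∀ x → Dec (Q x)) x xs →
    length (filter Q? (x ∷ xs)) · 1# ≡ indicator (Q? x) + length (filter Q? xs) · 1#
  length-filter-∷ Q? x xs with Q? x
  ... | yes _ = refl
  ... | no _  = sym (+-identityˡ _)

  intercept : Direction → AffinePoint → Carrier
  intercept (slope d) (a , b) = b - d * a
  intercept ∞         (a , b) = a

  dot-line : ∀ D c P → dot (line D c) (embed P) ≡ c - intercept D P
  dot-line (slope d) c (a , b) =
    solve 4 (λ d c a b → d :* a :+ :- :1 :* b :+ c :* :1 := c :- (b :- d :* a)) refl d c a b
  dot-line ∞         c (a , b) = solve 3 (λ c a b → :- :1 :* a :+ :0 :* b :+ c :* :1 := c :- a) refl c a b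

  size : Direction → Carrier → ℕ
  size D c = intersectionSize 𝓣 (line D c)

  -- The points are grouped by the line through `D` that contains them, so intersection numbers
  -- enter as elements of the field.
  ∑-intercept : ∀ D (g : Carrier → Carrier) T →
    ∑ T (λ P → g (intercept D P)) ≡ ∑ elements (λ c → intersectionSize T (line D c) · 1# * g c)
  ∑-intercept D g [] = sym (trans (∑-cong elements (λ c → zeroˡ (g c))) (∑-0 elements))
  ∑-intercept D g (P ∷ T) = begin
    g (intercept D P) + ∑ T (λ P → g (intercept D P))
      ≡⟨ cong₂ _+_ (sym (∑-indicator (intercept D P) g)) (∑-intercept D g T) ⟩
    ∑ elements (λ c → indicator (c ≟ intercept D P) * g c)
      + ∑ elements (λ c → intersectionSize T (line D c) · 1# * g c)
      ≡⟨ ∑-+ _ _ elements ⟨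
    ∑ elements (λ c → indicator (c ≟ intercept D P) * g c + intersectionSize T (line D c) · 1# * g c)
      ≡⟨ ∑-cong elements step ⟩
    ∑ elements (λ c → intersectionSize (P ∷ T) (line D c) · 1# * g c) ∎
    where
    step : ∀ c → indicator (c ≟ intercept D P) * g c + intersectionSize T (line D c) · 1# * g c ≡
      intersectionSize (P ∷ T) (line D c) · 1# * g c
    step c = begin
      indicator (c ≟ intercept D P) * g c + intersectionSize T (line D c) · 1# * g c
        ≡⟨ distribʳ (g c) _ _ ⟨
      (indicator (c ≟ intercept D P) + intersectionSize T (line D c) · 1#) * g c
        ≡⟨ cong (λ x → (x + intersectionSize T (line D c) · 1#) * g c)
             (indicator-⇔ (c ≟ intercept D P) (dot (line D c) (embed P) ≟ 0#) incident on-line) ⟩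
      (indicator (dot (line D c) (embed P) ≟ 0#) + intersectionSize T (line D c) · 1#) * g c
        ≡⟨ cong (_* g c) (length-filter-∷ (λ P → dot (line D c) (embed P) ≟ 0#) P T) ⟨
      intersectionSize (P ∷ T) (line D c) · 1# * g c ∎
      where
      incident : c ≡ intercept D P → dot (line D c) (embed P) ≡ 0#
      incident c≡ = trans (dot-line D c P) (trans (cong (λ x → x - intercept D P) c≡) (-‿inverseʳ _))

      on-line : dot (line D c) (embed P) ≡ 0# → c ≡ intercept D P
      on-line dot≡0 = x∙y⁻¹≈ε⇒x≈y _ _ (trans (sym (dot-line D c P)) dot≡0)

  weight : Direction → ℕ → Carrier → Carrier
  weight D t c = size D c · 1# - t · 1#

  atypical : Direction → ℕ → List Carrier
  atypical D t = filter (λ c → ¬? (size D c ≡ₘ? t)) elements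

  residual : Direction → ℕ → Exponentials
  residual D t = map (λ c → weight D t c , c) (atypical D t)

  weight-typical : ∀ {D t c} → size D c ≡ₘ t → weight D t c ≡ 0#
  weight-typical {D} {t} {c} = ∣⇒difference≡0 (size D c) t

  weight-atypical : ∀ {D t c} → ¬ size D c ≡ₘ t → weight D t c ≢ 0#
  weight-atypical {D} {t} {c} c-atypical ≡0 = c-atypical (difference≡0⇒∣ (size D c) t ≡0)

  -- The typical intersection number t contributes t ∑ cʲ = 0 to the power sums.
  power-sums : ∀ D t j → suc j ℕ.< q →
    expSum (map (λ P → 1# , intercept D P) 𝓣) j ≡ expSum (residual D t) j
  power-sums D t j j<q = begin
    expSum (map (λ P → 1# , intercept D P) 𝓣) j
      ≡⟨ expSum-∑ (λ _ → 1#) (intercept D) 𝓣 j ⟩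
    ∑ 𝓣 (λ P → 1# * intercept D P ^ j)
      ≡⟨ ∑-intercept D (λ c → 1# * c ^ j) 𝓣 ⟩
    ∑ elements (λ c → size D c · 1# * (1# * c ^ j))
      ≡⟨ ∑-cong elements (λ c → solve 3 (λ s t x → s :* (:1 :* x) := (s :- t) :* x :+ t :* x)
           refl (size D c · 1#) (t · 1#) (c ^ j)) ⟩
    ∑ elements (λ c → weight D t c * c ^ j + t · 1# * c ^ j)
      ≡⟨ ∑-+ _ _ elements ⟩
    ∑ elements (λ c → weight D t c * c ^ j) + ∑ elements (λ c → t · 1# * c ^ j)
      ≡⟨ cong₂ _+_ refl (trans (∑-*ˡ (t · 1#) (_^ j) elements)
           (trans (cong (t · 1# *_) (power-sum-vanishes j j<q)) (zeroʳ _))) ⟩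
    ∑ elements (λ c → weight D t c * c ^ j) + 0#
      ≡⟨ +-identityʳ _ ⟩
    ∑ elements (λ c → weight D t c * c ^ j)
      ≡⟨ ∑-filter (λ c → ¬? (size D c ≡ₘ? t)) _ typical-term elements ⟨
    ∑ (atypical D t) (λ c → weight D t c * c ^ j)
      ≡⟨ expSum-∑ (weight D t) id (atypical D t) j ⟨
    expSum (residual D t) j ∎
    where
    typical-term : ∀ c → ¬ ¬ (size D c ≡ₘ t) → weight D t c * c ^ j ≡ 0#
    typical-term c ¬¬typical = trans
      (cong (_* c ^ j) (weight-typical {D} {t} {c} (decidable-stable (size D c ≡ₘ? t) ¬¬typical)))
      (zeroˡ _)

  -- From j ≤ 2 l - 1 follows j + 1 ≤ 2 l < q. The exponent 2 l - 1 does occur: entry 2 l - 2 of the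
  -- moments involves it.
  power-sums-below : ∀ D t j → j ℕ.< l ℕ.+ l →
    expSum (map (λ P → 1# , intercept D P) 𝓣) j ≡ expSum (residual D t) j
  power-sums-below D t j j<2l = power-sums D t j
    (ℕ.≤-<-trans j<2l (subst (λ k → l ℕ.+ k ℕ.< q) (ℕ.+-identityʳ l) 2l<q))

  length-atypical : ∀ D t → linesMeetingIn D t ℕ.+ length (atypical D t) ≡ q
  length-atypical D t = trans (length-filter-¬ (λ c → size D c ≡ₘ? t) elements) length-elements

  l≤q : l ℕ.≤ q
  l≤q = ℕ.≤-trans (ℕ.m≤m+n l _) (ℕ.<⇒≤ 2l<q)

  length-atypical-≤ : ∀ D t m → m ℕ.≤ q → Typical (q ∸ m) D t → length (atypical D t) ℕ.≤ m
  length-atypical-≤ D t m m≤q typical = ℕ.+-cancelˡ-≤ (q ∸ m) _ _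
    (subst (q ∸ m ℕ.+ length (atypical D t) ℕ.≤_)
      (trans (length-atypical D t) (sym (ℕ.m∸n+n≡m m≤q)))
      (ℕ.+-monoˡ-≤ _ typical))

  momentsAt : Direction → Carrier → Row
  momentsAt D b = expSum (map (λ P → b - intercept D P , intercept D P) 𝓣)

  -- An instance of the congruence lemma for the identity homomorphism with τ = 1 and d = 0, where
  -- divisibility is equality.
  momentsAt-∑ : ∀ D t b j → suc j ℕ.< l ℕ.+ l →
    momentsAt D b j ≡ ∑ (atypical D t) (λ c → weight D t c * (b - c) * c ^ j)
  momentsAt-∑ D t b j j<2l = begin
    momentsAt D b j
      ≡⟨ x∙y⁻¹≈ε⇒x≈y _ _ (0∣x⇒x≈0 (Id.∣-expSum-twist (intercept D) (intercept D)
           (λ P → ∣-respʳ-≈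
             (sym (trans (cong (λ y → intercept D P - y) (*-identityʳ _)) (-‿inverseʳ _))) (0# ∣0))
           𝓣 (residual D t) (l ℕ.+ l) (power-sums-below D t) j j<2l)) ⟩
    expSum (Id.twist b 1# (residual D t)) j
      ≡⟨ cong (λ ν → expSum ν j) (map-∘ (atypical D t)) ⟨
    expSum (map (λ c → weight D t c * (b - c * 1#) , c * 1#) (atypical D t)) j
      ≡⟨ expSum-∑ _ _ (atypical D t) j ⟩
    ∑ (atypical D t) (λ c → weight D t c * (b - c * 1#) * (c * 1#) ^ j)
      ≡⟨ ∑-cong (atypical D t) (λ c → cong (λ x → weight D t c * (b - x) * x ^ j) (*-identityʳ c)) ⟩
    ∑ (atypical D t) (λ c → weight D t c * (b - c) * c ^ j) ∎

  determinantAt : Direction → Carrier → Carrier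
  determinantAt D b = hankel (momentsAt D b) l unit (upTo l)

  upTo-< : ∀ n → All (ℕ._< n) (upTo n)
  upTo-< n = All.applyUpTo⁺₁ id n id

  -- The term of the atypical intercept b has weight factor b - b = 0. At most l - 1 exponentials
  -- remain for l rows, and divisibility by a positive power of 0 forces the value 0.
  determinantAt-renitent : ∀ D b → Renitent (q ∸ l) D b → determinantAt D b ≡ 0#
  determinantAt-renitent D b (t , typical , b-atypical) = 0∣x⇒x≈0 (∣-respˡ-≈ 0^≡0
    (hankel-expSum-∣ {0#} {momentsAt D b} l l ν (ℕ.<⇒≤ |ν|<l) congruent (upTo-< l)))
    where
    others : List Carrier
    others = filter (λ c → ¬? (c ≟ b)) (atypical D t)

    ν : Exponentials
    ν = map (λ c → weight D t c * (b - c) , c) others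

    |ν|<l : length ν ℕ.< l
    |ν|<l = subst (ℕ._< l) (sym (length-map _ others)) (ℕ.<-≤-trans
      (filter-notAll (λ c → ¬? (c ≟ b)) (atypical D t)
        (lose (∈-filter⁺ (λ c → ¬? (size D c ≡ₘ? t)) (∈-elements b) b-atypical) (λ b≢b → b≢b refl)))
      (length-atypical-≤ D t l l≤q typical))

    -- The exponent must be positive, as 0⁰ = 1; this is where the strict bound on the number of
    -- terms enters.
    0^≡0 : 0# ^ (l ∸ length ν) ≡ 0#
    0^≡0 with suc n ← l ∸ length ν | _ ← ℕ.m<n⇒0<n∸m |ν|<l = zeroˡ _

    b-term : ∀ j c → ¬ c ≢ b → weight D t c * (b - c) * c ^ j ≡ 0#
    b-term j c ¬c≢b with c ≟ b
    ... | yes refl = trans (cong (λ x → weight D t c * x * c ^ j) (-‿inverseʳ c))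
      (trans (cong (_* c ^ j) (zeroʳ _)) (zeroˡ _))
    ... | no c≢b   = contradiction c≢b ¬c≢b

    congruent : ∀ j → suc j ℕ.< l ℕ.+ l → 0# ∣ momentsAt D b j - expSum ν j
    congruent j j<2l = ∣-respʳ-≈ (sym (trans (cong (_- expSum ν j) (begin
      momentsAt D b j
        ≡⟨ momentsAt-∑ D t b j j<2l ⟩
      ∑ (atypical D t) (λ c → weight D t c * (b - c) * c ^ j)
        ≡⟨ ∑-filter (λ c → ¬? (c ≟ b)) _ (b-term j) (atypical D t) ⟨
      ∑ others (λ c → weight D t c * (b - c) * c ^ j)
        ≡⟨ expSum-∑ _ id others j ⟨
      expSum ν j ∎)) (-‿inverseʳ _))) (0# ∣0)

  -- For b the intercept of a typical line, b - c is nonzero at each of the exactly l atypical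
  -- intercepts c, so the exponential sum has full length.
  determinantAt-sharp : ∀ D → SharplyUniform (q ∸ l) D → ∃[ b ] determinantAt D b ≢ 0#
  determinantAt-sharp D (t , _ , exact) = b , λ ≡0 → hankel-expSum-≉0 l ν |ν|≡l weights distinct
    (trans (sym (hankel-cong-below l l expand (upTo-< l))) ≡0)
    where
    member : ∀ {B : Set} (xs : List B) → 0 ℕ.< length xs → ∃[ x ] x ∈ xs
    member (x ∷ xs) _ = x , here refl

    l<q : l ℕ.< q
    l<q = ℕ.≤-<-trans (ℕ.m≤m+n l _) 2l<q

    typicalLine : ∃[ b ] b ∈ filter (λ c → size D c ≡ₘ? t) elements
    typicalLine = member _ (subst (0 ℕ.<_) (sym exact) (ℕ.m<n⇒0<n∸m l<q))

    b = proj₁ typicalLine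

    b-typical : size D b ≡ₘ t
    b-typical = proj₂ (∈-filter⁻ (λ c → size D c ≡ₘ? t) {xs = elements} (proj₂ typicalLine))

    ν : Exponentials
    ν = map (λ c → weight D t c * (b - c) , c) (atypical D t)

    |ν|≡l : length ν ≡ l
    |ν|≡l = trans (length-map _ (atypical D t)) (ℕ.+-cancelˡ-≡ (q ∸ l) _ _ (begin
      q ∸ l ℕ.+ length (atypical D t)                ≡⟨ cong (ℕ._+ length (atypical D t)) exact ⟨
      linesMeetingIn D t ℕ.+ length (atypical D t)   ≡⟨ length-atypical D t ⟩
      q                                              ≡⟨ ℕ.m∸n+n≡m l≤q ⟨
      q ∸ l ℕ.+ l                                    ∎))

    weight≢0 : ∀ {c} → c ∈ atypical D t → weight D t c * (b - c) ≢ 0#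
    weight≢0 {c} c∈ with c-atypical ← proj₂ (∈-filter⁻ (λ c → ¬? (size D c ≡ₘ? t)) {xs = elements} c∈) =
      *-≢0 (weight-atypical {D} {t} {c} c-atypical)
        (difference≉0 (λ b≡c → c-atypical (subst (λ x → size D x ≡ₘ t) b≡c b-typical)))

    expand : ∀ j → suc j ℕ.< l ℕ.+ l → momentsAt D b j ≡ expSum ν j
    expand j j<2l = trans (momentsAt-∑ D t b j j<2l) (sym (expSum-∑ _ id (atypical D t) j))

    weights : All (λ (α , _) → α ≢ 0#) ν
    weights = All.map⁺ (All.tabulate weight≢0)

    distinct : Distinct (nodes ν)
    distinct = subst Distinct (trans (sym (map-id (atypical D t))) (map-∘ (atypical D t)))
      (AllPairs.map (λ x≢y y≡x → x≢y (sym y≡x))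
        (filter⁺ (λ c → ¬? (size D c ≡ₘ? t)) elements-unique))

  -- The determinant as a form on the dual plane.

  W : Poly
  W = (1# , 0 ∷ 0 ∷ 1 ∷ []) ∷ []

  -- The intercept of the line [u : v : w] is w, and the line contains (a , b)
  -- if and only if w equals - (a u + b v).
  interceptForm : AffinePoint → Poly
  interceptForm (a , b) = (- a , 1 ∷ 0 ∷ 0 ∷ []) ∷ (- b , 0 ∷ 1 ∷ 0 ∷ []) ∷ []

  moments : PC.Row
  moments = PC.expSum (map (λ P → W P.- interceptForm P , interceptForm P) 𝓣)

  determinant : Poly
  determinant = PC.hankel moments l PC.unit (upTo l)

  determinant-homogeneous : Homogeneous (l ℕ.^ 2) determinant
  determinant-homogeneous = Terms-homogeneous determinant (subst (λ n → Terms n determinant)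
    (trans (hankel-degree 0 l) (cong (l ℕ.*_) (sym (ℕ.*-identityʳ l))))
    (Terms-hankel l (λ j → Terms-expSum _ interceptForm
      (λ P → Terms-+ (refl ∷ []) (Terms-neg (interceptForm-terms P))) interceptForm-terms 𝓣 j) (upTo l)))
    where
    interceptForm-terms : ∀ P → Terms 1 (interceptForm P)
    interceptForm-terms P = refl ∷ refl ∷ []

  eval-W : ∀ D b → eval W (line D b) ≡ b
  eval-W (slope d) b = solve 1 (λ b → :1 :* (:1 :* (:1 :* (b :* :1 :* :1))) :+ :0 := b) refl b
  eval-W ∞         b = solve 1 (λ b → :1 :* (:1 :* (:1 :* (b :* :1 :* :1))) :+ :0 := b) refl b

  eval-interceptForm : ∀ D b P → eval (interceptForm P) (line D b) ≡ intercept D P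
  eval-interceptForm (slope d) c (a , b) = solve 3 (λ d a b →
    :- a :* (d :* :1 :* (:1 :* (:1 :* :1))) :+ (:- b :* (:1 :* (:- :1 :* :1 :* (:1 :* :1))) :+ :0) :=
    b :- d :* a) refl d a b
  eval-interceptForm ∞         c (a , b) = solve 2 (λ a b →
    :- a :* (:- :1 :* :1 :* (:1 :* (:1 :* :1))) :+ (:- b :* (:1 :* (:0 :* :1 :* (:1 :* :1))) :+ :0) :=
    a) refl a b

  eval-determinant : ∀ D b → eval determinant (line D b) ≡ determinantAt D b
  eval-determinant D b = Eval.homo-hankel l (Eval.homo-expSum _ interceptForm _ (intercept D)
    (λ P → trans (eval-+ (line D b) W (-ₚ interceptForm P))
      (cong₂ _+_ (eval-W D b)
        (trans (eval-neg (line D b) (interceptForm P)) (cong -_ (eval-interceptForm D b P)))))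
    (eval-interceptForm D b) 𝓣) (upTo l)
    where module Eval = Homomorphism polyRing commutativeRing (eval-isRingHomomorphism (line D b))

  eval-pencil : ∀ D b → eval (pencil (point D)) (line D b) ≡ 0#
  eval-pencil (slope d) b = solve 2 (λ d b →
    :1 :* (d :* :1 :* (:1 :* (:1 :* :1))) :+ (d :* (:1 :* (:- :1 :* :1 :* (:1 :* :1))) :+
    (:0 :* (:1 :* (:1 :* (b :* :1 :* :1))) :+ :0)) := :0) refl d b
  eval-pencil ∞ b = solve 1 (λ b →
    :0 :* (:- :1 :* :1 :* (:1 :* (:1 :* :1))) :+ (:1 :* (:1 :* (:0 :* :1 :* (:1 :* :1))) :+
    (:0 :* (:1 :* (:1 :* (b :* :1 :* :1))) :+ :0)) := :0) refl b

  -- This form is 1 at every affine line through D, so that modulo the pencil of D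
  -- the form interceptForm P is intercept D P times it.
  scaleForm : Direction → Poly
  scaleForm (slope _) = (- 1# , 0 ∷ 1 ∷ 0 ∷ []) ∷ []
  scaleForm ∞         = (- 1# , 1 ∷ 0 ∷ 0 ∷ []) ∷ []

  -- For slope d, - a U - b V + (b - d a) V = - a (U + d V), whence the cofactor - a; for ∞ the
  -- difference is - b V.
  pencil-∣ : ∀ D P → pencil (point D) ∣ₚ (interceptForm P P.- (constant (intercept D P) *ₚ scaleForm D))
  pencil-∣ (slope d) (a , b) = constant (- a) ,
    pairing⇒≈ₚ (constant (- a) *ₚ pencil (point (slope d)))
      (interceptForm (a , b) P.- (constant (b - d * a) *ₚ scaleForm (slope d)))
      (λ φ → solve 6 (λ d a b u v w →
        :- a :* :1 :* u :+ (:- a :* d :* v :+ (:- a :* :0 :* w :+ :0)) :=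
        :- a :* u :+ (:- b :* v :+ (:- ((b :- d :* a) :* :- :1) :* v :+ :0)))
        refl d a b (φ _) (φ _) (φ _))
  pencil-∣ ∞ (a , b) = constant (- b) ,
    pairing⇒≈ₚ (constant (- b) *ₚ pencil (point ∞))
      (interceptForm (a , b) P.- (constant a *ₚ scaleForm ∞))
      (λ φ → solve 5 (λ a b u v w →
        :- b :* :0 :* u :+ (:- b :* :1 :* v :+ (:- b :* :0 :* w :+ :0)) :=
        :- a :* u :+ (:- b :* v :+ (:- (a :* :- :1) :* u :+ :0)))
        refl a b (φ _) (φ _) (φ _))

  -- With n ≤ m atypical lines the determinant is divisible by the pencil to the power l - n, hence
  -- also to the power l - m.
  pencil-^-∣ : ∀ D m → m ℕ.≤ l → Uniform (q ∸ m) D → (pencil (point D) ^ₚ (l ∸ m)) ∣ₚ determinant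
  pencil-^-∣ D m m≤l (t , typical) = PD.∣ʳ-trans
    (^-∣-^ (ℕ.∸-monoʳ-≤ l atypical≤m))
    (subst (λ n → (pencil (point D) ^ₚ (l ∸ n)) ∣ₚ determinant) |ν|≡
      (PC.hankel-expSum-∣ {pencil (point D)} {moments} l l ν
        (subst (ℕ._≤ l) (sym |ν|≡) (ℕ.≤-trans atypical≤m m≤l))
        (Constant.∣-expSum-twist interceptForm (intercept D) (pencil-∣ D) 𝓣 (residual D t)
          (l ℕ.+ l) (power-sums-below D t))
        (upTo-< l)))
    where
    import Algebra.Properties.Semiring.Divisibility P.semiring as PD
    open import Algebra.Properties.Semiring.Exp P.semiring using (^-homo-*)

    atypical≤m : length (atypical D t) ℕ.≤ m
    atypical≤m = length-atypical-≤ D t m (ℕ.≤-trans m≤l l≤q) typical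

    ν : PC.Exponentials
    ν = Constant.twist W (scaleForm D) (residual D t)

    |ν|≡ : length ν ≡ length (atypical D t)
    |ν|≡ = trans (length-map _ (residual D t)) (length-map _ (atypical D t))

    ^-∣-^ : ∀ {f i j} → i ℕ.≤ j → (f ^ₚ i) ∣ₚ (f ^ₚ j)
    ^-∣-^ {f} {i} {j} i≤j = f ^ₚ (j ∸ i) ,
      P.trans {(f ^ₚ (j ∸ i)) *ₚ (f ^ₚ i)} {f ^ₚ (j ∸ i ℕ.+ i)} {f ^ₚ j}
      (P.sym {f ^ₚ (j ∸ i ℕ.+ i)} {(f ^ₚ (j ∸ i)) *ₚ (f ^ₚ i)} (^-homo-* f (j ∸ i) i))
      (P.reflexive (cong (f ^ₚ_) (ℕ.m∸n+n≡m i≤j)))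

  determinant-sharp : ∀ D → SharplyUniform (q ∸ l) D → ∃[ b ] eval determinant (line D b) ≢ 0#
  determinant-sharp D sharp = proj₁ witness ,
    λ ≡0 → proj₂ witness (trans (sym (eval-determinant D (proj₁ witness))) ≡0)
    where
    witness : ∃[ b ] determinantAt D b ≢ 0#
    witness = determinantAt-sharp D sharp

  ∣ₚ-eval : ∀ {f g} v → f ∣ₚ g → eval f v ≡ 0# → eval g v ≡ 0#
  ∣ₚ-eval {f} {g} v (k , k*f≈g) f≡0 = begin
    eval g v            ≡⟨ eval-cong {k *ₚ f} {g} v k*f≈g ⟨
    eval (k *ₚ f) v     ≡⟨ eval-* v k f ⟩
    eval k v * eval f v ≡⟨ cong (eval k v *_) f≡0 ⟩
    eval k v * 0#       ≡⟨ zeroʳ _ ⟩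
    0#                  ∎

  -- The pencil form vanishes at every line through `D`, so a multiple of it would too; the
  -- determinant does not vanish at the typical line found above.
  pencil-∤ : ∀ D → SharplyUniform (q ∸ l) D → ¬ (pencil (point D) ∣ₚ determinant)
  pencil-∤ D sharp pencil∣ = proj₂ witness
    (∣ₚ-eval {pencil (point D)} {determinant} (line D (proj₁ witness)) pencil∣
      (eval-pencil D (proj₁ witness)))
    where
    witness : ∃[ b ] eval determinant (line D b) ≢ 0#
    witness = determinant-sharp D sharp

  envelope : ∃[ D ] SharplyUniform (q ∸ l) D → Envelope (l ℕ.^ 2)
  envelope (D , sharp) = record
    { form        = determinant
    ; homogeneous = determinant-homogeneous
    ; nonzero     = λ ≈0 → proj₂ (determinant-sharp D sharp)
                      (eval-cong {determinant} {0ₚ} (line D _) ≈0)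
    }

open import Data.Nat using (_*_; _^_; _≤_; _<_)

theorem3p3 : ∀ (p h q : ℕ) → Prime p → q ≡ p ^ h →
    (F : FiniteField q) →
    let open Plane F in
    (𝓣 : Multiset) →
    let open Uniformity p 𝓣 in
    (l : ℕ) → 0 < l → 2 * l ≤ q ∸ 1 →
    (𝓔 : List Direction) → Unique 𝓔 → length 𝓔 ≤ q →
    (∀ D → D ∈ 𝓔 → Uniform (q ∸ l) D) →
    (∃[ D ] D ∈ 𝓔 × SharplyUniform (q ∸ l) D) →
    Σ[ 𝓖 ∈ Envelope (l ^ 2) ]
    (∀ D b → D ∈ 𝓔 → Renitent (q ∸ l) D b → ContainsLine 𝓖 (line D b)) ×
    (∀ D m → D ∈ 𝓔 → m < l → Uniform (q ∸ m) D →
    ContainsPencilWithMultiplicity 𝓖 D (l ∸ m)) ×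
    (∀ D → SharplyUniform (q ∸ l) D → ¬ ContainsPencil 𝓖 D)
theorem3p3 p h q p-prime q≡pʰ F 𝓣 l 0<l 2l≤q-1 𝓔 _ _ _ (D , _ , sharp) =
    envelope (D , sharp)
  , (λ D b _ renitent → trans (eval-determinant D b) (determinantAt-renitent D b renitent))
  , (λ D m _ m<l uniform → pencil-^-∣ D m (ℕ.<⇒≤ m<l) uniform)
  , pencil-∤
  where
  -- Subtraction is truncated, so q ≥ 1 has to be known first; it follows from 0 < l ≤ 2 l ≤ q ∸ 1.
  2l<q : 2 * l < q
  2l<q = ℕ.≤-trans (s≤s 2l≤q-1) (ℕ.≤-reflexive (ℕ.m+[n∸m]≡n 1≤q))
    where
    1≤q : 1 ≤ q
    1≤q = ℕ.≤-trans (ℕ.≤-trans 0<l (ℕ.m≤m+n l _)) (ℕ.≤-trans 2l≤q-1 (ℕ.m∸n≤m q 1))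

  open RenitentEnvelope {h = h} p-prime q≡pʰ F 𝓣 l 0<l 2l<q
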